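{- Let $t \geq 0$ and $c \geq 1$ be integers. \textsc{Dominating Set} admits a PTAS when restricted to VPG graphs with a representation $\mathcal{R} = (\mathcal{G}, \mathcal{P})$ (given as part of the input) such that: (1) each path in $\mathcal{P}$ has a polynomial (in $|\mathcal{P}|$) number of bends; (2) each grid-edge in $\mathcal{G}$ belongs to at most $t$ paths in $\mathcal{P}$; (3) the horizontal part of each path in $\mathcal{P}$ has length at most $c$.
   Context: All graphs are finite and simple. A dominating set of a graph $G$ is a set $D\subseteq V(G)$ such that each vertex of $V(G)\setminus D$ is adjacent to a vertex of $D$. \textsc{Dominating Set} is the problem of finding a minimum-size dominating set of a graph $G$; its optimum is $\gamma(G)$. A PTAS for it is a family of algorithms, one for each fixed $0<\varepsilon<1$, running in time polynomial in the input size and returning a dominating set of size at most $(1+\varepsilon)\gamma(G)$. A path on a rectangular grid is a simple path made of grid-edges (at least one); a bend is a $90$ degree turn at a grid-point. A graph $G$ is VPG if there is a collection $\mathcal{P}$ of paths on a grid $\mathcal{G}$, in one-to-one correspondence with $V(G)$, such that two distinct vertices are adjacent in $G$ if and only if the corresponding paths share at least one grid-point. The pair $(\mathcal{G},\mathcal{P})$ is a VPG representation of $G$. The horizontal part of a path $P$ is the interval $[x^P_{\min},x^P_{\max}]$ obtained by projecting $P$ onto the horizontal axis; its length is measured in number of grid-edges (grid-steps). In condition (1) the bounding polynomial is fixed. Encoding of a representation: for the grid only the grid-step (length of a grid-edge) is stored. For each path $P\in\mathcal{P}$ one stores (1) the sequence $s(P)$ of the first endpoint, all bend-points in order of appearance,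 and the last endpoint; (2) for all $P'\neq P$ intersecting $P$, the first intersection point of $P$ with $P'$ when traversing $P$ from first to last endpoint, sorted in order of appearance; (3) for all such $P'$, the last intersection point of $P$ with $P'$, sorted in order of appearance when traversing $P$ from last to first endpoint. -}

module Defs where

open import Data.Bool.Base using (Bool; true; false; if_then_else_; T)
open import Data.Fin.Base using (Fin; zero; toℕ)
open import Data.Fin.Properties using () renaming (_≟_ to _≟ᶠ_)
open import Data.Fin.Subset using (Subset; ∣_∣; _∈_; _∉_)
open import Data.Integer.Base as ℤ using (ℤ; +_; -[1+_])
import Data.Integer.Properties as ℤ
open import Data.List.Base
  using (List; []; _∷_; _∷ʳ_; allFin; concatMap; filter; foldr; head; length; map; reverse; zip)
open import Data.List.Extrema ℤ.≤-totalOrder using (min; max)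
import Data.List.NonEmpty.Base as List⁺
import Data.List.Membership.DecPropositional as DecMembership
open import Data.List.Relation.Unary.Linked using (Linked)
open import Data.List.Relation.Unary.Unique.Propositional using (Unique)
import Data.List.Membership.Propositional as Membership
import Data.Maybe.Properties as Maybe
open import Data.Maybe.Base using (just)
open import Data.Nat.Base using (ℕ; suc; _+_; _*_; _≤_; NonZero)
open import Data.Nat.Binary.Base as ℕᵇ using (ℕᵇ; 2[1+_]; 1+[2_])
open import Data.Product.Base using (_×_; _,_; ∃; ∃-syntax; proj₁)
import Data.Product.Properties as Product
open import Data.Rational.Base as ℚ using (ℚ; 0ℚ; 1ℚ)
open import Data.Sum.Base using (_⊎_)
open import Data.Vec.Base as Vec using (Vec; lookup; _[_]≔_; replicate)
open import Function.Bundles using (_⇔_)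
open import Relation.Binary.Definitions using (DecidableEquality)
open import Relation.Binary.PropositionalEquality.Core using (_≡_; _≢_)
open import Relation.Nullary.Decidable using (Dec; does; ¬?; _×-dec_; _⊎-dec_)

-- Polynomials with natural coefficients, constant coefficient first.

Polynomial : Set
Polynomial = List ℕ

eval : Polynomial → ℕ → ℕ
eval p x = foldr (λ a r → a + x * r) 0 p

-- Model of computation: Jones's WHILE language over binary trees
-- (N. D. Jones, "Computability and Complexity", MIT Press, 1997).  Up to
-- polynomial factors, its running time agrees with that of Turing
-- machines.  There is no unit-cost equality test on trees, and
-- arithmetic has to be programmed on binary representations.

infixr 5 _∙_

data Tree : Set where
  nil : Tree
  _∙_ : Tree → Tree → Tree

size : Tree → ℕ
size nil     = 1
size (a ∙ b) = 1 + size a + size b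

left right : Tree → Tree
left nil      = nil
left (a ∙ b)  = a
right nil     = nil
right (a ∙ b) = b

data Expr (k : ℕ) : Set where
  var   : Fin k → Expr k
  nil   : Expr k
  cons  : Expr k → Expr k → Expr k
  hd tl : Expr k → Expr k

infix  6 _:=_
infixr 5 _⨾_

data Command (k : ℕ) : Set where
  _:=_          : Fin k → Expr k → Command k
  _⨾_           : Command k → Command k → Command k
  if_run_else_  : Expr k → Command k → Command k → Command k
  while_loop_   : Expr k → Command k → Command k

Store : ℕ → Set
Store k = Vec Tree k

⟦_⟧ : ∀ {k} → Expr k → Store k → Tree
⟦ var x ⟧    σ = lookup σ x
⟦ nil ⟧      σ = nil
⟦ cons e f ⟧ σ = ⟦ e ⟧ σ ∙ ⟦ f ⟧ σ
⟦ hd e ⟧     σ = left (⟦ e ⟧ σ)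
⟦ tl e ⟧     σ = right (⟦ e ⟧ σ)

cost : ∀ {k} → Expr k → ℕ
cost (var x)    = 1
cost nil        = 1
cost (cons e f) = 1 + cost e + cost f
cost (hd e)     = 1 + cost e
cost (tl e)     = 1 + cost e

-- ⟨ C , σ ⟩⇓⟨ τ , m ⟩: started in store σ, the command C terminates in
-- store τ after time m.  As a condition, nil is false and every other
-- tree is true.

infix 4 ⟨_,_⟩⇓⟨_,_⟩

data ⟨_,_⟩⇓⟨_,_⟩ {k : ℕ} : Command k → Store k → Store k → ℕ → Set where
  assign : ∀ {x e σ} →
    ⟨ x := e , σ ⟩⇓⟨ σ [ x ]≔ ⟦ e ⟧ σ , 1 + cost e ⟩
  seq : ∀ {C D σ τ υ m n} →
    ⟨ C , σ ⟩⇓⟨ τ , m ⟩ → ⟨ D , τ ⟩⇓⟨ υ , n ⟩ →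
    ⟨ C ⨾ D , σ ⟩⇓⟨ υ , 1 + m + n ⟩
  if-true : ∀ {e C D σ τ m} →
    ⟦ e ⟧ σ ≢ nil → ⟨ C , σ ⟩⇓⟨ τ , m ⟩ →
    ⟨ if e run C else D , σ ⟩⇓⟨ τ , 1 + cost e + m ⟩
  if-false : ∀ {e C D σ τ m} →
    ⟦ e ⟧ σ ≡ nil → ⟨ D , σ ⟩⇓⟨ τ , m ⟩ →
    ⟨ if e run C else D , σ ⟩⇓⟨ τ , 1 + cost e + m ⟩
  while-true : ∀ {e C σ τ υ m n} →
    ⟦ e ⟧ σ ≢ nil → ⟨ C , σ ⟩⇓⟨ τ , m ⟩ → ⟨ while e loop C , τ ⟩⇓⟨ υ , n ⟩ →
    ⟨ while e loop C , σ ⟩⇓⟨ υ , 1 + cost e + m + n ⟩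
  while-false : ∀ {e C σ} →
    ⟦ e ⟧ σ ≡ nil →
    ⟨ while e loop C , σ ⟩⇓⟨ σ , 1 + cost e ⟩

-- Variable 0 holds the input and, at the end, the output; the other
-- variables are initially nil.

record Program : Set where
  field
    #auxiliary : ℕ
    body       : Command (suc #auxiliary)

Computes_On_InTime_ : Program → Tree → ℕ → Tree → Set
Computes_On_InTime_ P input m output =
  ∃[ τ ] ⟨ body , input Vec.∷ replicate #auxiliary nil ⟩⇓⟨ τ , m ⟩ × lookup τ zero ≡ output
  where open Program P

record Graph (n : ℕ) : Set where
  field
    adj         : Fin n → Fin n → Bool
    symmetric   : ∀ u v → adj u v ≡ adj v u
    irreflexive : ∀ v → adj v v ≡ false

  Adjacent : Fin n → Fin n → Set
  Adjacent u v = T (adj u v)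

open Graph public using (Adjacent)

Dominating : ∀ {n} → Graph n → Subset n → Set
Dominating G D = ∀ v → v ∉ D → ∃[ u ] u ∈ D × Adjacent G v u

record IsDominationNumber {n} (G : Graph n) (γ : ℕ) : Set where
  field
    attained : ∃[ D ] Dominating G D × ∣ D ∣ ≡ γ
    minimal  : ∀ D → Dominating G D → γ ≤ ∣ D ∣

-- Paths on a grid.  A grid-point is given by its column and row; its
-- position in the plane depends on the grid-step and is only relevant to
-- the encoding below.

Point : Set
Point = ℤ × ℤ

_≟ᵖ_ : DecidableEquality Point
_≟ᵖ_ = Product.≡-dec ℤ._≟_ ℤ._≟_

open Membership using () renaming (_∈_ to _∈ˡ_)
open DecMembership _≟ᵖ_ using () renaming (_∈?_ to _∈ᵖ?_)
open DecMembership (Product.≡-dec _≟ᵖ_ _≟ᵖ_) using () renaming (_∈?_ to _∈ᵉ?_)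

GridEdge : Point → Point → Set
GridEdge (x , y) (x′ , y′) = ℤ.∣ x ℤ.- x′ ∣ + ℤ.∣ y ℤ.- y′ ∣ ≡ 1

-- The grid-edges pq and qr are perpendicular.

Turn : Point → Point → Point → Set
Turn (x , y) (x′ , y′) (x″ , y″) =
  (x′ ℤ.- x) ℤ.* (x″ ℤ.- x′) ℤ.+ (y′ ℤ.- y) ℤ.* (y″ ℤ.- y′) ≡ ℤ.0ℤ

turn? : ∀ p q r → Dec (Turn p q r)
turn? p q r = _ ℤ.≟ _

turns : List Point → List Point
turns (p ∷ ps@(q ∷ r ∷ _)) = if does (turn? p q r) then q ∷ turns ps else turns ps
turns _                    = []

record Path : Set where
  field
    start next : Point
    rest       : List Point

  points : List Point
  points = start ∷ next ∷ rest

  field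
    linked : Linked GridEdge points
    simple : Unique points

  end : Point
  end = List⁺.last (next List⁺.∷ rest)

  bends : List Point
  bends = turns points

  xmin xmax : ℤ
  xmin = min (proj₁ start) (map proj₁ points)
  xmax = max (proj₁ start) (map proj₁ points)

  horizontalLength : ℤ
  horizontalLength = xmax ℤ.- xmin

  Uses : Point → Point → Set
  Uses p q = (p , q) ∈ˡ zip points (next ∷ rest) ⊎ (q , p) ∈ˡ zip points (next ∷ rest)

  uses? : ∀ p q → Dec (Uses p q)
  uses? p q = (p , q) ∈ᵉ? zip points (next ∷ rest) ⊎-dec (q , p) ∈ᵉ? zip points (next ∷ rest)

open Path

Intersect : Path → Path → Set
Intersect P Q = ∃[ p ] p ∈ˡ points P × p ∈ˡ points Q

-- The unit of length is such that the grid-step is an integer, and the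
-- origin is a grid-point.

record Grid : Set where
  field
    step    : ℕ
    nonZero : NonZero step

record Representation {n} (G : Graph n) : Set where
  field
    grid     : Grid
    path     : Fin n → Path
    adjacent : ∀ u v → u ≢ v → Adjacent G u v ⇔ Intersect (path u) (path v)

record Instance : Set where
  field
    {n}            : ℕ
    graph          : Graph n
    representation : Representation graph

  open Representation representation public

  load : Point → Point → ℕ
  load p q = length (filter (λ v → uses? (path v) p q) (allFin n))

encodeBool : Bool → Tree
encodeBool false = nil
encodeBool true  = nil ∙ nil

encodeℕᵇ : ℕᵇ → Tree
encodeℕᵇ ℕᵇ.zero  = nil
encodeℕᵇ 2[1+ b ] = encodeBool false ∙ encodeℕᵇ b
encodeℕᵇ 1+[2 b ] = encodeBool true ∙ encodeℕᵇ b

encodeℕ : ℕ → Tree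
encodeℕ m = encodeℕᵇ (ℕᵇ.fromℕ m)

encodeℤ : ℤ → Tree
encodeℤ (+ m)    = encodeBool false ∙ encodeℕ m
encodeℤ -[1+ m ] = encodeBool true ∙ encodeℕ m

encodeList : ∀ {A : Set} → (A → Tree) → List A → Tree
encodeList f = foldr (λ a t → f a ∙ t) nil

encodeSubset : ∀ {n} → Subset n → Tree
encodeSubset D = encodeList encodeBool (Vec.toList D)

encodeGraph : ∀ {n} → Graph n → Tree
encodeGraph {n} G =
  encodeList (λ u → encodeList (λ v → encodeBool (Graph.adj G u v)) (allFin n)) (allFin n)

module _ {n} {G : Graph n} (R : Representation G) where
  open Representation R
  open Grid grid

  encodePoint : Point → Tree
  encodePoint (x , y) = encodeℤ (+ step ℤ.* x) ∙ encodeℤ (+ step ℤ.* y)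

  -- For ps the points of the path of u in the order of a traversal, all
  -- pairs (v , p) with v ≠ u and p the first point of ps on the path of
  -- v, sorted by the appearance of p in ps and then by v.

  firstIntersections : Fin n → List Point → List (Fin n × Point)
  firstIntersections u ps = concatMap (λ p → map (_, p) (filter (first? p) (allFin n))) ps
    where
    first? : ∀ p v → Dec (v ≢ u × head (filter (_∈ᵖ? points (path v)) ps) ≡ just p)
    first? p v = ¬? (v ≟ᶠ u) ×-dec Maybe.≡-dec _≟ᵖ_ _ _

  encodeIntersections : List (Fin n × Point) → Tree
  encodeIntersections = encodeList (λ (v , p) → encodeℕ (toℕ v) ∙ encodePoint p)

  -- The last intersection points are the first ones of the reversed
  -- traversal.

  encodePath : Fin n → Tree
  encodePath u =
    encodeList encodePoint (start P ∷ bends P ∷ʳ end P)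
      ∙ encodeIntersections (firstIntersections u (points P))
      ∙ encodeIntersections (firstIntersections u (reverse (points P)))
    where P = path u

  encodeRepresentation : Tree
  encodeRepresentation = encodeℕ step ∙ encodeList encodePath (allFin n)

encode : Instance → Tree
encode I = encodeGraph graph ∙ encodeRepresentation representation
  where open Instance I

record Restricted (b : Polynomial) (t c : ℕ) (I : Instance) : Set where
  open Instance I
  field
    fewBends : ∀ v → length (bends (path v)) ≤ eval b n
    fewPaths : ∀ p q → GridEdge p q → load p q ≤ t
    narrow   : ∀ v → horizontalLength (path v) ℤ.≤ + c

fromℕ : ℕ → ℚ
fromℕ m = + m ℚ./ 1

-- P is required to behave well only on the instances in 𝒞.

record IsApproximationAlgorithm (𝒞 : Instance → Set) (ε : ℚ) (P : Program) : Set where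
  field
    time    : Polynomial
    correct : ∀ I → 𝒞 I → let open Instance I in
      ∃[ D ] ∃[ m ] ∃[ γ ]
        (Computes P On encode I InTime m) (encodeSubset D)
        × m ≤ eval time (size (encode I))
        × Dominating graph D
        × IsDominationNumber graph γ
        × fromℕ ∣ D ∣ ℚ.≤ (1ℚ ℚ.+ ε) ℚ.* fromℕ γ

DominatingSetHasPTAS : (Instance → Set) → Set
DominatingSetHasPTAS 𝒞 =
  ∀ ε → 0ℚ ℚ.< ε → ε ℚ.< 1ℚ → ∃ (IsApproximationAlgorithm 𝒞 ε)

{-# OPTIONS --safe #-}
module Submission where

-- The algorithm is local search: starting from the whole vertex set, a
-- dominating set is replaced by a smaller one at Hamming distance at
-- most K, with K constant, until no such set exists.  It only looks at
-- the adjacency matrix; the representation is needed for the analysis.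
-- Let L be locally optimal and O be optimal.  Send each vertex v to
-- members l v of L and o v of O that dominate it.  If A ⊆ L, B ⊆ O,
-- o v ∈ B whenever l v ∈ A, and ∣A∣ + ∣B∣ ≤ K, then (L ∖ A) ∪ B is
-- dominating, so ∣A∣ ≤ ∣B∣.  To each member u of L attach the interval
-- of rows visited by the paths of the v with l v = u, and similarly for
-- O.  In a slab of W consecutive columns, a row meets at most p of these
-- intervals, because of the bounds on the load and on the width of the
-- paths.  Cutting a slab along rows into pieces of bounded size
-- therefore gives enough exchanges to compare the parts of L and O in
-- it, up to a factor close to 1.  Members of O near the border of a slab
-- count for two slabs, which is negligible on average over the W ways to
-- divide the plane into slabs.

-- The exchange condition is one-sided: it survives shrinking `A` and enlarging `B`. Hence a cut may
-- drop the members of `A` that cross it and use those of `B` on both sides; nothing has to be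
-- matched up along the cut. Since the intervals of `l v` and `o v` both contain the rows of `v`,
-- they meet, so each side of a cut satisfies the condition again. A cut affects at most p crossing
-- members and takes at least r + 1 members out of the remaining problem, so the total loss is a
-- fraction p / (r + 1) of ∣A∣ + ∣B∣, small once r is large compared with p. Slabs are what makes p
-- a constant: an entire row can meet arbitrarily many paths. From `l v` via `v` to `o v` the column
-- changes by at most 2c, so a slab needs the members of O up to 2c columns beyond either border;
-- this is the origin of the 4c in the constants.

open import Data.Nat.Base
open import Data.Nat.Properties
open import Algebra.Properties.Semiring.Sum +-*-semiring
  using (sum; ∑-distrib-+; ∑-comm; *-distribˡ-sum; sum-cong-≗)
open import Data.Bool.Base using (Bool; true; false; T; not; if_then_else_; _∧_; _∨_; _xor_)
open import Data.Bool.Properties using (T?; T-≡; T-∧; T-∨)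
open import Data.Empty using (⊥; ⊥-elim)
open import Data.Fin.Base as Fin using (Fin; toℕ; fromℕ<)
open import Data.Fin.Patterns
open import Data.Fin.Properties using (any?; all?; toℕ-fromℕ<; toℕ<n) renaming (_≟_ to _≟ᶠ_)
open import Data.Fin.Subset using (Subset; ∣_∣; _∈_; ⊤)
open import Data.Fin.Subset.Properties using (_∈?_; anySubset?; ∈⊤)
open import Data.Integer.Base as ℤ using (ℤ; -[1+_]; +[1+_]; 0ℤ; 1ℤ; _-_; +≤+; -≤+; +<+) renaming (+_ to pos)
import Data.Integer.Properties as ℤ
import Data.Integer.Tactic.RingSolver as ℤ
open import Data.List.Base as List using (List; []; _∷_; length; filter; allFin; replicate; map; tabulate; zip; _ʳ++_)
open import Data.List.Extrema ≤-totalOrder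
  using (argmin; argmax; argmin-sel; argmax-sel; f[argmin]≤f[⊤]; f[argmin]≤f[xs]; f[⊥]≤f[argmax]; f[xs]≤f[argmax])
import Data.List.Extrema ℤ.≤-totalOrder as ℤᴱ
open import Data.List.Membership.Propositional using () renaming (_∈_ to _∈ˡ_)
open import Data.List.Membership.Propositional.Properties using (∈-allFin; ∈-filter⁺; ∈-filter⁻; ∈-map⁺)
open import Data.List.Properties using (length-tabulate; length-ʳ++; length-replicate; map-tabulate)
open import Data.List.Relation.Unary.All as All using (All; []; _∷_)
open import Data.List.Relation.Unary.Any using (here; there)
open import Data.List.Relation.Unary.Linked using (Linked; _∷_)
open import Data.Nat.Divisibility using (∣-refl)
open import Data.Nat.DivMod
  using (m≡m%n+[m/n]*n; m%n<n; m/n*n≤m; m/n≤m; /-monoˡ-≤; +-distrib-/-∣ʳ; n/n≡1; /-congˡ)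
open import Data.Nat.Tactic.RingSolver using (solve-∀)
open import Data.Product.Base using (_×_; _,_; ∃; ∃-syntax; proj₁; proj₂)
open import Data.Rational.Base as ℚ using (ℚ; mkℚ; 0ℚ; 1ℚ; toℚᵘ)
import Data.Rational.Properties as ℚ
open import Data.Rational.Unnormalised.Base as ℚᵘ using (mkℚᵘ; *≤*)
import Data.Rational.Unnormalised.Properties as ℚᵘ
open import Data.Sum.Base as Sum using (_⊎_; inj₁; inj₂; [_,_]′)
open import Data.Unit.Base using (tt)
open import Data.Vec.Base as Vec using ([]; _∷_; lookup)
open import Data.Vec.Properties using ([]=⇒lookup; lookup⇒[]=; lookup∘tabulate)
open import Function.Base using (_∘_; id)
open import Function.Bundles using (Equivalence)
open import Relation.Binary.PropositionalEquality
open import Relation.Nullary.Decidable using (Dec; yes; no; does; ¬?; _×-dec_; _⊎-dec_; _→-dec_)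
open import Relation.Nullary.Negation using (¬_)
open import Defs

open Equivalence using (to; from)

-- Timed execution

infix 4 ⟨_,_⟩⇓_within_

⟨_,_⟩⇓_within_ : ∀ {k} → Command k → Store k → Store k → ℕ → Set
⟨ C , σ ⟩⇓ τ within b = ∃[ m ] ⟨ C , σ ⟩⇓⟨ τ , m ⟩ × m ≤ b

module _ {k : ℕ} where

  private variable
    C D     : Command k
    e       : Expr k
    x       : Fin k
    σ τ υ   : Store k
    a b l   : ℕ

  assign≤ : ⟨ x := e , σ ⟩⇓ (σ Vec.[ x ]≔ ⟦ e ⟧ σ) within (1 + cost e)
  assign≤ = _ , assign , ≤-refl

  infixr 5 _⨟_ _⨟ʳ_
  _⨟_ : ⟨ C , σ ⟩⇓ τ within a → ⟨ D , τ ⟩⇓ υ within b → ⟨ C ⨾ D , σ ⟩⇓ υ within (1 + a + b)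
  (m , p , m≤a) ⨟ (n , q , n≤b) = _ , seq p q , s≤s (+-mono-≤ m≤a n≤b)

  -- With the bounds commuted, so that the numeral in front of the bound
  -- of the second command comes first and is computed with.
  _⨟ʳ_ : ⟨ C , σ ⟩⇓ τ within a → ⟨ D , τ ⟩⇓ υ within b → ⟨ C ⨾ D , σ ⟩⇓ υ within (1 + b + a)
  _⨟ʳ_ {a = a} {b = b} (m , p , m≤a) (n , q , n≤b) =
    _ , seq p q , s≤s (subst (m + n ≤_) (+-comm a b) (+-mono-≤ m≤a n≤b))

  weaken : a ≤ b → ⟨ C , σ ⟩⇓ τ within a → ⟨ C , σ ⟩⇓ τ within b
  weaken a≤b (m , p , m≤a) = m , p , ≤-trans m≤a a≤b

  -- The branches depend on the value of the condition, so the derivation for the branch not taken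
  -- is vacuous.
  if≤ : ∀ β → ⟦ e ⟧ σ ≡ encodeBool β →
        (β ≡ true → ⟨ C , σ ⟩⇓ τ within a) → (β ≡ false → ⟨ D , σ ⟩⇓ τ within a) →
        ⟨ if e run C else D , σ ⟩⇓ τ within (1 + cost e + a)
  if≤ {e = e} true p q r = let m , s , m≤a = q refl in
    _ , if-true (λ z → case≢ (trans (sym p) z)) s , +-monoʳ-≤ (1 + cost e) m≤a
    where
    case≢ : (nil ∙ nil) ≢ nil
    case≢ ()
  if≤ {e = e} false p q r = let m , s , m≤a = r refl in
    _ , if-false p s , +-monoʳ-≤ (1 + cost e) m≤a

  stop : ⟦ e ⟧ σ ≡ nil → ⟨ while e loop C , σ ⟩⇓ σ within (1 + cost e)
  stop p = _ , while-false p , ≤-refl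

  -- The bound is the final failing test plus `l` passes at a uniform price; in this shape each loop
  -- is bounded by induction on the list that it consumes.
  iterate : ⟦ e ⟧ σ ≢ nil → ⟨ C , σ ⟩⇓ τ within a →
    ⟨ while e loop C , τ ⟩⇓ υ within (1 + cost e + l * (1 + cost e + a)) →
    ⟨ while e loop C , σ ⟩⇓ υ within (1 + cost e + suc l * (1 + cost e + a))
  iterate {e = e} {a = a} {l = l} p (m , q , m≤a) (n , r , n≤) = _ , while-true p q r ,
    (begin
      1 + cost e + m + n                       ≤⟨ +-mono-≤ (+-monoʳ-≤ (1 + cost e) m≤a) n≤ ⟩
      A + (1 + cost e + l * A)                 ≡⟨ +-assoc A (1 + cost e) (l * A) ⟨
      A + (1 + cost e) + l * A                 ≡⟨ cong (_+ l * A) (+-comm A (1 + cost e)) ⟩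
      1 + cost e + A + l * A                   ≡⟨ +-assoc (1 + cost e) A (l * A) ⟩
      1 + cost e + (A + l * A)                 ∎)
    where
    open ≤-Reasoning
    A = 1 + cost e + a

-- Variables: 0 input, current set and output; 1 adjacency matrix;
-- 2 remaining rounds; 3 candidates; 4 candidates still to be expanded,
-- or whether the candidate is dominating; 5 rest of the candidate, or of
-- a row; 6 reversed prefix of the candidate, or whether the vertex is
-- dominated; 7 to 9 scratch.

Cmd : Set
Cmd = Command 10

enc : List Bool → Tree
enc = encodeList encodeBool

encs : List (List Bool) → Tree
encs = encodeList enc

unary : ℕ → Tree
unary zero    = nil
unary (suc k) = nil ∙ unary k

skip : Cmd
skip = 0F := var 0F

trueᵉ : Expr 10
trueᵉ = cons nil nil

-- A zipper runs along the candidate: `flip` emits the copy with the bit at the current position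
-- negated, then moves that bit to the reversed prefix. The old candidates stay in the list, so K
-- expansions reach every list at Hamming distance at most K.
unreverse flip expandOne expand : Cmd
unreverse = while var 8F loop (7F := cons (hd (var 8F)) (var 7F) ⨾ 8F := tl (var 8F))
flip      = if hd (var 5F) run (7F := cons nil (tl (var 5F))) else (7F := cons trueᵉ (tl (var 5F)))
  ⨾ 8F := var 6F ⨾ unreverse ⨾ 3F := cons (var 7F) (var 3F) ⨾ 7F := nil
  ⨾ 6F := cons (hd (var 5F)) (var 6F) ⨾ 5F := tl (var 5F)
expandOne = 5F := hd (var 4F) ⨾ 4F := tl (var 4F) ⨾ while var 5F loop flip ⨾ 6F := nil
expand    = 4F := var 3F ⨾ while var 4F loop expandOne

expands : ℕ → Cmd
expands zero    = skip
expands (suc K) = expand ⨾ expands K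

unreverse≤ : ∀ {d g m c q x p r} P Y →
  ⟨ unreverse , d ∷ g ∷ m ∷ c ∷ q ∷ x ∷ p ∷ enc Y ∷ enc P ∷ r ∷ [] ⟩⇓
    d ∷ g ∷ m ∷ c ∷ q ∷ x ∷ p ∷ enc (P ʳ++ Y) ∷ nil ∷ r ∷ [] within (2 + length P * 11)
unreverse≤ []      Y = stop refl
unreverse≤ (b ∷ P) Y = iterate {l = length P} (λ ()) (assign≤ ⨟ assign≤) (unreverse≤ P (b ∷ Y))

flips : List Bool → List Bool → List (List Bool) → List (List Bool)
flips P []      C = C
flips P (b ∷ X) C = flips (b ∷ P) X ((P ʳ++ (not b ∷ X)) ∷ C)

expandAll : List (List Bool) → List (List Bool) → List (List Bool)
expandAll []      C = C
expandAll (X ∷ Q) C = expandAll Q (flips [] X C)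

flip≤ : ∀ {d g m c q r} b P X →
  ⟨ flip , d ∷ g ∷ m ∷ c ∷ q ∷ enc (b ∷ X) ∷ enc P ∷ nil ∷ nil ∷ r ∷ [] ⟩⇓
    d ∷ g ∷ m ∷ (enc (P ʳ++ (not b ∷ X)) ∙ c) ∷ q ∷ enc X ∷ enc (b ∷ P) ∷ nil ∷ nil ∷ r ∷ []
    within (34 + length P * 11)
flip≤ {d} {g} {m} {c} {q} {r} b P X =
  if≤ {τ = d ∷ g ∷ m ∷ c ∷ q ∷ enc (b ∷ X) ∷ enc P ∷ enc (not b ∷ X) ∷ nil ∷ r ∷ []} {a = 7} b refl
    (λ { refl → weaken (m≤n+m 5 2) assign≤ }) (λ { refl → assign≤ })
  ⨟ assign≤ ⨟ unreverse≤ P (not b ∷ X) ⨟ʳ assign≤ ⨟ assign≤ ⨟ assign≤ ⨟ assign≤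

-- The sum of the two lengths is invariant, so `n` bounds the cost of every reversal of the prefix.
flips≤ : ∀ {n d g m q r} P X C → length P + length X ≤ n →
  ⟨ while var 5F loop flip , d ∷ g ∷ m ∷ encs C ∷ q ∷ enc X ∷ enc P ∷ nil ∷ nil ∷ r ∷ [] ⟩⇓
    d ∷ g ∷ m ∷ encs (flips P X C) ∷ q ∷ nil ∷ enc (X ʳ++ P) ∷ nil ∷ nil ∷ r ∷ []
    within (2 + length X * (36 + n * 11))
flips≤     P []      C _ = stop refl
flips≤ {n} P (b ∷ X) C p = iterate {l = length X} (λ ())
  (weaken (+-monoʳ-≤ 34 (*-monoˡ-≤ 11 (m+n≤o⇒m≤o (length P) p))) (flip≤ b P X))
  (flips≤ (b ∷ P) X _ (≤-trans (≤-reflexive (sym (+-suc (length P) (length X)))) p))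

expandTime : ℕ → ℕ
expandTime n = n * (36 + n * 11)

expandAll≤ : ∀ {n d g m r} Q C → All (λ X → length X ≡ n) Q →
  ⟨ while var 4F loop expandOne , d ∷ g ∷ m ∷ encs C ∷ encs Q ∷ nil ∷ nil ∷ nil ∷ nil ∷ r ∷ [] ⟩⇓
    d ∷ g ∷ m ∷ encs (expandAll Q C) ∷ nil ∷ nil ∷ nil ∷ nil ∷ nil ∷ r ∷ []
    within (2 + length Q * (15 + expandTime n))
expandAll≤ []      C _ = stop refl
expandAll≤ (X ∷ Q) C (refl ∷ ps) = iterate {l = length Q} (λ ())
  (assign≤ ⨟ assign≤ ⨟ flips≤ [] X C ≤-refl ⨟ʳ assign≤)
  (expandAll≤ Q _ ps)

-- Testing a candidate for domination and size

anyLoop rowBody countUp countDown select : Cmd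
anyLoop   = while var 5F loop ((if hd (var 5F) run (if hd (var 8F) run (6F := trueᵉ) else skip) else skip)
  ⨾ 5F := tl (var 5F) ⨾ 8F := tl (var 8F))
rowBody   = 6F := hd (var 7F) ⨾ 5F := hd (var 9F) ⨾ 8F := hd (var 3F) ⨾ anyLoop
  ⨾ (if var 6F run skip else (4F := nil)) ⨾ 6F := nil ⨾ 7F := tl (var 7F) ⨾ 9F := tl (var 9F)
countUp   = while var 7F loop ((if hd (var 7F) run (8F := cons nil (var 8F)) else skip) ⨾ 7F := tl (var 7F))
countDown = while var 7F loop ((if hd (var 7F) run (8F := tl (var 8F)) else skip) ⨾ 7F := tl (var 7F))
select    = 4F := trueᵉ ⨾ 9F := var 1F ⨾ 7F := hd (var 3F) ⨾ while var 9F loop rowBody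
  ⨾ 7F := var 0F ⨾ countUp ⨾ 7F := hd (var 3F) ⨾ countDown
  ⨾ (if var 4F run (if var 8F run (0F := hd (var 3F)) else skip) else skip)
  ⨾ 8F := nil ⨾ 4F := nil ⨾ 3F := tl (var 3F)

any⁺ : ∀ {n} → (Fin n → Bool) → (Fin n → Bool) → Bool → List (Fin n) → Bool
any⁺ a χ β []       = β
any⁺ a χ β (v ∷ vs) = any⁺ a χ ((a v ∧ χ v) ∨ β) vs

hit≤ : ∀ {d g m c q y r} a b β {s t} →
  ⟨ if hd (var 5F) run (if hd (var 8F) run (6F := trueᵉ) else skip) else skip ,
    d ∷ g ∷ m ∷ c ∷ q ∷ (encodeBool a ∙ s) ∷ encodeBool β ∷ y ∷ (encodeBool b ∙ t) ∷ r ∷ [] ⟩⇓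
    d ∷ g ∷ m ∷ c ∷ q ∷ (encodeBool a ∙ s) ∷ encodeBool ((a ∧ b) ∨ β) ∷ y ∷ (encodeBool b ∙ t) ∷ r ∷ []
    within 10
hit≤ true  true  β = if≤ true refl (λ _ → if≤ true refl (λ _ → assign≤) λ ()) λ ()
hit≤ true  false β = if≤ true refl (λ _ → if≤ false refl (λ ()) λ _ → weaken (m≤n+m 2 2) assign≤) λ ()
hit≤ false b     β = if≤ false refl (λ ()) λ _ → weaken (m≤n+m 2 5) assign≤

any≤ : ∀ {n d g m c q y r} (a χ : Fin n → Bool) β vs →
  ⟨ anyLoop , d ∷ g ∷ m ∷ c ∷ q ∷ encodeList (encodeBool ∘ a) vs ∷ encodeBool β ∷ y
      ∷ encodeList (encodeBool ∘ χ) vs ∷ r ∷ [] ⟩⇓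
    d ∷ g ∷ m ∷ c ∷ q ∷ nil ∷ encodeBool (any⁺ a χ β vs) ∷ y ∷ nil ∷ r ∷ []
    within (2 + length vs * 20)
any≤ a χ β []       = stop refl
any≤ a χ β (v ∷ vs) = iterate {l = length vs} (λ ()) (hit≤ (a v) (χ v) β ⨟ assign≤ ⨟ assign≤) (any≤ a χ _ vs)

module _ {n} (adj : Fin n → Fin n → Bool) (χ : Fin n → Bool) where

  -- Starting `any⁺` from `χ u` makes it a test of the closed neighbourhood of `u`.
  covers : Bool → List (Fin n) → Bool
  covers β []       = β
  covers β (u ∷ us) = covers (any⁺ (adj u) χ (χ u) (allFin n) ∧ β) us

  row≤ : ∀ {d g m c q x s t} b β →
    ⟨ if var 6F run skip else (4F := nil) ,
      d ∷ g ∷ m ∷ c ∷ encodeBool β ∷ q ∷ encodeBool b ∷ x ∷ s ∷ t ∷ [] ⟩⇓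
      d ∷ g ∷ m ∷ c ∷ encodeBool (b ∧ β) ∷ q ∷ encodeBool b ∷ x ∷ s ∷ t ∷ [] within 4
  row≤ true  β = if≤ true refl (λ _ → assign≤) λ ()
  row≤ false β = if≤ false refl (λ ()) λ _ → assign≤

  covers≤ : ∀ {d g m c} β us →
    ⟨ while var 9F loop rowBody ,
      d ∷ g ∷ m ∷ (encodeList (encodeBool ∘ χ) (allFin n) ∙ c) ∷ encodeBool β ∷ nil ∷ nil
        ∷ encodeList (encodeBool ∘ χ) us ∷ nil ∷ encodeList (λ u → encodeList (λ v → encodeBool (adj u v)) (allFin n)) us ∷ [] ⟩⇓
      d ∷ g ∷ m ∷ (encodeList (encodeBool ∘ χ) (allFin n) ∙ c) ∷ encodeBool (covers β us) ∷ nil ∷ nil ∷ nil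
        ∷ nil ∷ nil ∷ []
      within (2 + length us * (32 + length (allFin n) * 20))
  covers≤ β []       = stop refl
  covers≤ β (u ∷ us) = iterate {l = length us} (λ ())
    (assign≤ ⨟ assign≤ ⨟ assign≤ ⨟ any≤ (adj u) χ (χ u) (allFin n)
      ⨟ʳ row≤ (any⁺ (adj u) χ (χ u) (allFin n)) β ⨟ assign≤ ⨟ assign≤ ⨟ assign≤)
    (covers≤ _ us)

#true : List Bool → ℕ
#true []          = 0
#true (true ∷ X)  = suc (#true X)
#true (false ∷ X) = #true X

-- Sizes are compared in unary: the counter goes up along the current set and down along the
-- candidate, truncated at zero. It ends nonzero exactly when the candidate is strictly smaller.
plus : ℕ → List Bool → ℕ
plus k []          = k
plus k (true ∷ X)  = plus (suc k) X
plus k (false ∷ X) = plus k X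

minus : ℕ → List Bool → ℕ
minus k []          = k
minus k (true ∷ X)  = minus (pred k) X
minus k (false ∷ X) = minus k X

plus≤ : ∀ {d g m c q x p r} k X →
  ⟨ countUp , d ∷ g ∷ m ∷ c ∷ q ∷ x ∷ p ∷ enc X ∷ unary k ∷ r ∷ [] ⟩⇓
    d ∷ g ∷ m ∷ c ∷ q ∷ x ∷ p ∷ nil ∷ unary (plus k X) ∷ r ∷ [] within (2 + length X * 13)
plus≤ k []          = stop refl
plus≤ k (true ∷ X)  = iterate {l = length X} (λ ()) (if≤ true refl (λ _ → assign≤) (λ ()) ⨟ assign≤) (plus≤ (suc k) X)
plus≤ k (false ∷ X) = iterate {l = length X} (λ ())
  (if≤ false refl (λ ()) (λ _ → weaken (m≤n+m 2 2) assign≤) ⨟ assign≤) (plus≤ k X)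

minus≤ : ∀ {d g m c q x p r} k X →
  ⟨ countDown , d ∷ g ∷ m ∷ c ∷ q ∷ x ∷ p ∷ enc X ∷ unary k ∷ r ∷ [] ⟩⇓
    d ∷ g ∷ m ∷ c ∷ q ∷ x ∷ p ∷ nil ∷ unary (minus k X) ∷ r ∷ [] within (2 + length X * 12)
minus≤ k       []          = stop refl
minus≤ zero    (true ∷ X)  = iterate {l = length X} (λ ())
  (if≤ true refl (λ _ → assign≤) (λ ()) ⨟ assign≤) (minus≤ zero X)
minus≤ (suc k) (true ∷ X)  = iterate {l = length X} (λ ())
  (if≤ true refl (λ _ → assign≤) (λ ()) ⨟ assign≤) (minus≤ k X)
minus≤ k       (false ∷ X) = iterate {l = length X} (λ ())
  (if≤ false refl (λ ()) (λ _ → weaken (m≤n+m 2 1) assign≤) ⨟ assign≤) (minus≤ k X)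

encodeList-tabulate : ∀ {A : Set} (f : A → Tree) {n} (g : Fin n → A) →
  encodeList f (List.tabulate g) ≡ encodeList (f ∘ g) (allFin n)
encodeList-tabulate {A} f g = trans (cong (encodeList f) (sym (map-tabulate id g))) (go (allFin _))
  where
  go : ∀ us → encodeList f (List.map g us) ≡ encodeList (f ∘ g) us
  go []       = refl
  go (u ∷ us) = cong (_ ∙_) (go us)

-- Positions beyond the end count as false.
at : List Bool → ℕ → Bool
at []      _       = false
at (b ∷ X) zero    = b
at (b ∷ X) (suc i) = at X i

tabulate-at : ∀ {n} X → length X ≡ n → List.tabulate {n = n} (λ v → at X (toℕ v)) ≡ X
tabulate-at []      refl = refl
tabulate-at (b ∷ X) refl = cong (b ∷_) (tabulate-at X refl)

choose : ∀ {A : Set} → Bool → ℕ → A → A → A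
choose false k       x y = y
choose true  zero    x y = y
choose true  (suc k) x y = x

choose≤ : ∀ {d g m x c s p y r} b k →
  ⟨ if var 4F run (if var 8F run (0F := hd (var 3F)) else skip) else skip ,
    d ∷ g ∷ m ∷ (x ∙ c) ∷ encodeBool b ∷ s ∷ p ∷ y ∷ unary k ∷ r ∷ [] ⟩⇓
    choose b k x d ∷ g ∷ m ∷ (x ∙ c) ∷ encodeBool b ∷ s ∷ p ∷ y ∷ unary k ∷ r ∷ [] within 7
choose≤ false k       = if≤ false refl (λ ()) λ _ → weaken (m≤n+m 2 3) assign≤
choose≤ true  zero    = if≤ true refl (λ _ → if≤ false refl (λ ()) λ _ → weaken (m≤n+m 2 1) assign≤) λ ()
choose≤ true  (suc k) = if≤ true refl (λ _ → _ , if-true (λ ()) assign , ≤-refl) λ ()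

expandN : ℕ → List (List Bool) → List (List Bool)
expandN zero    C = C
expandN (suc K) C = expandN K (expandAll C C)

coverTime selectTime : ℕ → ℕ
coverTime n  = n * (32 + n * 20)
selectTime n = 41 + (n * 12 + (2 + n * 13) + (2 + coverTime n))

module LocalSearch {n} (adj : Fin n → Fin n → Bool) where

  matrix : List (Fin n) → Tree
  matrix = encodeList λ u → encodeList (λ v → encodeBool (adj u v)) (allFin n)

  dominates : List Bool → Bool
  dominates X = covers adj (λ v → at X (toℕ v)) true (allFin n)

  better : List Bool → List Bool → List Bool
  better X D = choose (dominates X) (minus (plus 0 D) X) X D

  best : List (List Bool) → List Bool → List Bool
  best []      D = D
  best (X ∷ C) D = best C (better X D)

  better-all : ∀ {P : List Bool → Set} X D → P X → P D → P (better X D)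
  better-all X D p q with dominates X | minus (plus 0 D) X
  ... | false | _     = q
  ... | true  | zero  = q
  ... | true  | suc _ = p

  best-all : ∀ {P : List Bool → Set} C D → All P C → P D → P (best C D)
  best-all         []      D _        q = q
  best-all {P = P} (X ∷ C) D (p ∷ ps) q = best-all C _ ps (better-all {P = P} X D p q)

  dominates≤ : ∀ {d m c} X → length X ≡ n →
    ⟨ while var 9F loop rowBody ,
      d ∷ matrix (allFin n) ∷ m ∷ (enc X ∙ c) ∷ encodeBool true ∷ nil ∷ nil ∷ enc X ∷ nil ∷ matrix (allFin n) ∷ [] ⟩⇓
      d ∷ matrix (allFin n) ∷ m ∷ (enc X ∙ c) ∷ encodeBool (dominates X) ∷ nil ∷ nil ∷ nil ∷ nil ∷ nil ∷ []
      within (2 + coverTime n)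
  dominates≤ X p
    rewrite trans (cong enc (sym (tabulate-at X p))) (encodeList-tabulate encodeBool {n} (λ v → at X (toℕ v)))
    = weaken (≤-reflexive (cong (λ k → 2 + k * (32 + k * 20)) (length-tabulate {n = n} id)))
        (covers≤ adj _ true (allFin n))

  select≤ : ∀ {m c} X D → length X ≡ n → length D ≡ n →
    ⟨ select , enc D ∷ matrix (allFin n) ∷ m ∷ (enc X ∙ c) ∷ nil ∷ nil ∷ nil ∷ nil ∷ nil ∷ nil ∷ [] ⟩⇓
      enc (better X D) ∷ matrix (allFin n) ∷ m ∷ c ∷ nil ∷ nil ∷ nil ∷ nil ∷ nil ∷ nil ∷ [] within selectTime n
  select≤ X D p q =
    assign≤ ⨟ assign≤ ⨟ assign≤ ⨟ dominates≤ X p ⨟ʳ assign≤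
    ⨟ weaken (≤-reflexive (cong (λ k → 2 + k * 13) q)) (plus≤ 0 D) ⨟ʳ assign≤
    ⨟ weaken (≤-reflexive (cong (λ k → 2 + k * 12) p)) (minus≤ (plus 0 D) X)
    ⨟ʳ chosen ⨟ assign≤ ⨟ assign≤ ⨟ assign≤
    where
    -- `enc` commutes with `choose` only after the case distinction.
    chosen : ∀ {g m c s p y r} →
      ⟨ if var 4F run (if var 8F run (0F := hd (var 3F)) else skip) else skip ,
        enc D ∷ g ∷ m ∷ (enc X ∙ c) ∷ encodeBool (dominates X) ∷ s ∷ p ∷ y ∷ unary (minus (plus 0 D) X) ∷ r ∷ [] ⟩⇓
        enc (better X D) ∷ g ∷ m ∷ (enc X ∙ c) ∷ encodeBool (dominates X) ∷ s ∷ p ∷ y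
          ∷ unary (minus (plus 0 D) X) ∷ r ∷ [] within 7
    chosen with dominates X | minus (plus 0 D) X
    ... | false | k     = choose≤ false k
    ... | true  | zero  = choose≤ true zero
    ... | true  | suc k = choose≤ true (suc k)

  best≤ : ∀ {m} C D → All (λ X → length X ≡ n) C → length D ≡ n →
    ⟨ while var 3F loop select , enc D ∷ matrix (allFin n) ∷ m ∷ encs C ∷ nil ∷ nil ∷ nil ∷ nil ∷ nil ∷ nil ∷ [] ⟩⇓
      enc (best C D) ∷ matrix (allFin n) ∷ m ∷ nil ∷ nil ∷ nil ∷ nil ∷ nil ∷ nil ∷ nil ∷ []
      within (2 + length C * (2 + selectTime n))
  best≤ []      D _        q = stop refl
  best≤ (X ∷ C) D (p ∷ ps) q = iterate {l = length C} (λ ()) (select≤ X D p q)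
    (best≤ C (better X D) ps (better-all {P = λ Y → length Y ≡ n} X D p q))

-- The number of candidates

length-flips : ∀ P X C → length (flips P X C) ≡ length X + length C
length-flips P []      C = refl
length-flips P (b ∷ X) C = trans (length-flips (b ∷ P) X _) (+-suc (length X) (length C))

flips-all : ∀ {n} P X C → length P + length X ≡ n →
            All (λ Y → length Y ≡ n) C → All (λ Y → length Y ≡ n) (flips P X C)
flips-all P []      C p ps = ps
flips-all P (b ∷ X) C p ps = flips-all (b ∷ P) X _ (trans (sym (+-suc (length P) (length X))) p)
  (trans (length-ʳ++ P) p ∷ ps)

length-expandAll : ∀ {n} Q C → All (λ X → length X ≡ n) Q → length (expandAll Q C) ≡ length Q * n + length C
length-expandAll     []      C []          = refl
length-expandAll {n} (X ∷ Q) C (refl ∷ ps) = begin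
  length (expandAll Q (flips [] X C))   ≡⟨ length-expandAll Q _ ps ⟩
  length Q * n + length (flips [] X C)  ≡⟨ cong (length Q * n +_) (length-flips [] X C) ⟩
  length Q * n + (n + length C)         ≡⟨ +-assoc (length Q * n) n (length C) ⟨
  length Q * n + n + length C           ≡⟨ cong (_+ length C) (+-comm (length Q * n) n) ⟩
  n + length Q * n + length C           ∎
  where open ≡-Reasoning

expandAll-all : ∀ {n} Q C → All (λ X → length X ≡ n) Q → All (λ X → length X ≡ n) C →
                All (λ X → length X ≡ n) (expandAll Q C)
expandAll-all []      C _        qs = qs
expandAll-all (X ∷ Q) C (p ∷ ps) qs = expandAll-all Q _ ps (flips-all [] X C p qs)

length-expand : ∀ {n} C → All (λ X → length X ≡ n) C → length (expandAll C C) ≡ length C * suc n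
length-expand {n} C ps = trans (length-expandAll C C ps)
  (trans (+-comm (length C * n) (length C)) (sym (*-suc (length C) n)))

expandN-all : ∀ {n} K C → All (λ X → length X ≡ n) C → All (λ X → length X ≡ n) (expandN K C)
expandN-all zero    C ps = ps
expandN-all (suc K) C ps = expandN-all K _ (expandAll-all C C ps ps)

length-expandN : ∀ {n} K C → All (λ X → length X ≡ n) C → length (expandN K C) ≡ length C * suc n ^ K
length-expandN     zero    C ps = sym (*-identityʳ (length C))
length-expandN {n} (suc K) C ps = begin
  length (expandN K (expandAll C C))   ≡⟨ length-expandN K _ (expandAll-all C C ps ps) ⟩
  length (expandAll C C) * suc n ^ K   ≡⟨ cong (_* suc n ^ K) (length-expand C ps) ⟩
  length C * suc n * suc n ^ K         ≡⟨ *-assoc (length C) (suc n) (suc n ^ K) ⟩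
  length C * (suc n * suc n ^ K)       ∎
  where open ≡-Reasoning

-- The last argument is the current number of candidates, which each expansion multiplies by
-- `suc n`; this remains polynomial because the depth of the recursion is the constant `K`.
expandsTime : ℕ → ℕ → ℕ → ℕ
expandsTime n zero    l = 2
expandsTime n (suc K) l = 6 + (l * (15 + expandTime n) + expandsTime n K (l * suc n))

expands≤ : ∀ {n d g m r} K C → All (λ X → length X ≡ n) C →
  ⟨ expands K , d ∷ g ∷ m ∷ encs C ∷ nil ∷ nil ∷ nil ∷ nil ∷ nil ∷ r ∷ [] ⟩⇓
    d ∷ g ∷ m ∷ encs (expandN K C) ∷ nil ∷ nil ∷ nil ∷ nil ∷ nil ∷ r ∷ []
    within expandsTime n K (length C)
expands≤     zero    C ps = assign≤
expands≤ {n} (suc K) C ps = (assign≤ ⨟ expandAll≤ C C ps) ⨟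
  weaken (≤-reflexive (cong (expandsTime n K) (length-expand C ps)))
    (expands≤ K (expandAll C C) (expandAll-all C C ps ps))

-- The whole program and its running time

module _ (K : ℕ) where

  -- The rows of the adjacency matrix serve as a unary counter, first to write down the full vertex
  -- set and then to run n rounds. That many suffice, since a round that changes the set makes it
  -- smaller.
  round main : Cmd
  round = 3F := cons (var 0F) nil ⨾ expands K ⨾ (while var 3F loop select) ⨾ 2F := tl (var 2F)
  main  = 1F := hd (var 0F) ⨾ 0F := nil
    ⨾ 2F := var 1F ⨾ while var 2F loop (0F := cons trueᵉ (var 0F) ⨾ 2F := tl (var 2F))
    ⨾ 2F := var 1F ⨾ while var 2F loop round

  roundTime mainTime : ℕ → ℕ
  roundTime n = 10 + (2 + suc n ^ K * (2 + selectTime n) + expandsTime n K 1)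
  mainTime n  = 16 + (n * (2 + roundTime n) + (2 + n * 12))

  module _ {n} (adj : Fin n → Fin n → Bool) where
    open LocalSearch adj

    improve : List Bool → List Bool
    improve D = best (expandN K (D ∷ [])) D

    rounds : ℕ → List Bool → List Bool
    rounds zero    D = D
    rounds (suc k) D = rounds k (improve D)

    length-improve : ∀ D → length D ≡ n → length (improve D) ≡ n
    length-improve D p = best-all {P = λ X → length X ≡ n} _ D (expandN-all K _ (p ∷ [])) p

    round≤ : ∀ {t m} D → length D ≡ n →
      ⟨ round , enc D ∷ matrix (allFin n) ∷ (t ∙ m) ∷ nil ∷ nil ∷ nil ∷ nil ∷ nil ∷ nil ∷ nil ∷ [] ⟩⇓
        enc (improve D) ∷ matrix (allFin n) ∷ m ∷ nil ∷ nil ∷ nil ∷ nil ∷ nil ∷ nil ∷ nil ∷ [] within roundTime n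
    round≤ D p = assign≤ ⨟ expands≤ K (D ∷ []) (p ∷ [])
      ⨟ʳ weaken (≤-reflexive (cong (λ l → 2 + l * (2 + selectTime n))
             (trans (length-expandN K (D ∷ []) (p ∷ [])) (*-identityˡ _))))
           (best≤ (expandN K (D ∷ [])) D (expandN-all K _ (p ∷ [])) p)
      ⨟ʳ assign≤

    rounds≤ : ∀ {k} D us → length us ≡ k → length D ≡ n →
      ⟨ while var 2F loop round ,
        enc D ∷ matrix (allFin n) ∷ matrix us ∷ nil ∷ nil ∷ nil ∷ nil ∷ nil ∷ nil ∷ nil ∷ [] ⟩⇓
        enc (rounds k D) ∷ matrix (allFin n) ∷ nil ∷ nil ∷ nil ∷ nil ∷ nil ∷ nil ∷ nil ∷ nil ∷ []
        within (2 + length us * (2 + roundTime n))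
    rounds≤ D []       refl p = stop refl
    rounds≤ D (u ∷ us) refl p = iterate {l = length us} (λ ()) (round≤ D p) (rounds≤ _ us refl (length-improve D p))

    start≤ : ∀ {g c q x p y z r l} k us → length us + k ≡ l →
      ⟨ while var 2F loop (0F := cons trueᵉ (var 0F) ⨾ 2F := tl (var 2F)) ,
        enc (replicate k true) ∷ g ∷ matrix us ∷ c ∷ q ∷ x ∷ p ∷ y ∷ z ∷ r ∷ [] ⟩⇓
        enc (replicate l true) ∷ g ∷ nil ∷ c ∷ q ∷ x ∷ p ∷ y ∷ z ∷ r ∷ [] within (2 + length us * 12)
    start≤ k []       refl = stop refl
    start≤ k (u ∷ us) p    = iterate {l = length us} (λ ()) (assign≤ ⨟ assign≤)
      (start≤ (suc k) us (trans (+-suc (length us) k) p))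

    main≤ : ∀ {t} → ∃[ τ ]
      ⟨ main , (matrix (allFin n) ∙ t) ∷ nil ∷ nil ∷ nil ∷ nil ∷ nil ∷ nil ∷ nil ∷ nil ∷ nil ∷ [] ⟩⇓
      enc (rounds n (replicate n true)) ∷ τ within mainTime n
    main≤ = _ , weaken (≤-reflexive (cong (λ l → 16 + (l * (2 + roundTime n) + (2 + l * 12))) size≡n))
      (assign≤ ⨟ assign≤ ⨟ assign≤
      ⨟ start≤ 0 (allFin n) (trans (+-identityʳ _) size≡n) ⨟ʳ assign≤
      ⨟ rounds≤ (replicate n true) (allFin n) size≡n (length-replicate n))
      where
      size≡n = length-tabulate {n = n} id

-- Local optimality

-- Hamming distance between lists of equal length.
data Differ : ℕ → List Bool → List Bool → Set where
  []   : Differ 0 [] []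
  same : ∀ {k X Y} b → Differ k X Y → Differ k (b ∷ X) (b ∷ Y)
  diff : ∀ {k X Y} b → Differ k X Y → Differ (suc k) (b ∷ X) (not b ∷ Y)

Differ-refl : ∀ X → Differ 0 X X
Differ-refl []      = []
Differ-refl (b ∷ X) = same b (Differ-refl X)

Differ-zero : ∀ {X Y} → Differ 0 X Y → X ≡ Y
Differ-zero []         = refl
Differ-zero (same b d) = cong (b ∷_) (Differ-zero d)

-- `Z` corrects the first differing position; iterated, this decomposes a distance into single
-- flips, one for each expansion.
Differ-split : ∀ {k X Y} → Differ (suc k) X Y → ∃[ Z ] Differ 1 X Z × Differ k Z Y
Differ-split (same b d) = let Z , p , q = Differ-split d in b ∷ Z , same b p , same b q
Differ-split (diff b d) = _ , diff b (Differ-refl _) , same (not b) d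

flips-⊇ : ∀ P X C {Y} → Y ∈ˡ C → Y ∈ˡ flips P X C
flips-⊇ P []      C p = p
flips-⊇ P (b ∷ X) C p = flips-⊇ (b ∷ P) X _ (there p)

flips-complete : ∀ {X Y} P C → Differ 1 X Y → P ʳ++ Y ∈ˡ flips P X C
flips-complete P C (same b d) = flips-complete (b ∷ P) _ d
flips-complete P C (diff {X = X} b d) =
  flips-⊇ (b ∷ P) X (_ ∷ C) (here (cong (λ Y → P ʳ++ (not b ∷ Y)) (sym (Differ-zero d))))

expandAll-⊇ : ∀ Q C {Y} → Y ∈ˡ C → Y ∈ˡ expandAll Q C
expandAll-⊇ []      C p = p
expandAll-⊇ (X ∷ Q) C p = expandAll-⊇ Q _ (flips-⊇ [] X C p)

expandAll-complete : ∀ {X Y} Q C → X ∈ˡ Q → Differ 1 X Y → Y ∈ˡ expandAll Q C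
expandAll-complete (X ∷ Q) C (here refl) d = expandAll-⊇ Q _ (flips-complete [] C d)
expandAll-complete (X ∷ Q) C (there p)   d = expandAll-complete Q _ p d

-- Expansions beyond the distance do no harm, because they keep the candidates already found.
expandN-complete : ∀ {k X Y} K C → k ≤ K → X ∈ˡ C → Differ k X Y → Y ∈ˡ expandN K C
expandN-complete {zero}  zero    C _       p d = subst (_∈ˡ C) (Differ-zero d) p
expandN-complete {zero}  (suc K) C _       p d = expandN-complete K _ z≤n (expandAll-⊇ C C p) d
expandN-complete {suc k} (suc K) C (s≤s l) p d = let Z , e , f = Differ-split d in
  expandN-complete K _ l (expandAll-complete C C p e) f

plus-#true : ∀ k X → plus k X ≡ k + #true X
plus-#true k []          = sym (+-identityʳ k)
plus-#true k (true ∷ X)  = trans (plus-#true (suc k) X) (sym (+-suc k (#true X)))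
plus-#true k (false ∷ X) = plus-#true k X

minus-#true : ∀ k X → minus k X ≡ k ∸ #true X
minus-#true k       []          = refl
minus-#true zero    (true ∷ X)  = trans (minus-#true zero X) (0∸n≡0 (#true X))
minus-#true (suc k) (true ∷ X)  = minus-#true k X
minus-#true k       (false ∷ X) = minus-#true k X

module _ {n} (a χ : Fin n → Bool) where

  any⁺-sound : ∀ β vs → T (any⁺ a χ β vs) → T β ⊎ ∃[ v ] T (a v) × T (χ v)
  any⁺-sound β []       t = inj₁ t
  any⁺-sound β (v ∷ vs) t with any⁺-sound _ vs t
  ... | inj₂ p = inj₂ p
  ... | inj₁ p = [ (λ q → inj₂ (v , to T-∧ q)) , inj₁ ]′ (to T-∨ p)

  any⁺-true : ∀ β vs → T β → T (any⁺ a χ β vs)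
  any⁺-true β []       t = t
  any⁺-true β (v ∷ vs) t = any⁺-true _ vs (from T-∨ (inj₂ t))

  any⁺-complete : ∀ {v} β vs → v ∈ˡ vs → T (a v) → T (χ v) → T (any⁺ a χ β vs)
  any⁺-complete β (v ∷ vs) (here refl) s t = any⁺-true _ vs (from T-∨ (inj₁ (from T-∧ (s , t))))
  any⁺-complete β (v ∷ vs) (there p)   s t = any⁺-complete _ vs p s t

module _ {n} (adj : Fin n → Fin n → Bool) (χ : Fin n → Bool) where

  Covered : Fin n → Set
  Covered u = T (χ u) ⊎ ∃[ v ] T (adj u v) × T (χ v)

  -- The flag is only ever lowered, so its final truth certifies the test of every vertex on the
  -- way.
  covers-flag : ∀ β us → T (covers adj χ β us) → T β
  covers-flag β []       t = t
  covers-flag β (u ∷ us) t = proj₂ (to (T-∧ {any⁺ (adj u) χ (χ u) (allFin n)}) (covers-flag _ us t))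

  covers-sound : ∀ {u} β us → u ∈ˡ us → T (covers adj χ β us) → Covered u
  covers-sound β (u ∷ us) (here refl) t =
    any⁺-sound (adj u) χ (χ u) (allFin n) (proj₁ (to T-∧ (covers-flag _ us t)))
  covers-sound β (u ∷ us) (there p)   t = covers-sound _ us p t

  covers-complete : ∀ β us → T β → (∀ u → Covered u) → T (covers adj χ β us)
  covers-complete β []       t f = t
  covers-complete β (u ∷ us) t f = covers-complete _ us (from T-∧ ([ any⁺-true (adj u) χ (χ u) (allFin n)
    , (λ (v , p , q) → any⁺-complete (adj u) χ (χ u) (allFin n) (∈-allFin v) p q) ]′ (f u) , t)) f

module _ {n} (adj : Fin n → Fin n → Bool) where
  open LocalSearch adj

  data Better (X D : List Bool) : Set where
    kept     : better X D ≡ D → (T (dominates X) → #true D ≤ #true X) → Better X D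
    replaced : better X D ≡ X → T (dominates X) → #true X < #true D → Better X D

  minus-plus : ∀ X D → minus (plus 0 D) X ≡ #true D ∸ #true X
  minus-plus X D = trans (minus-#true _ X) (cong (_∸ #true X) (plus-#true 0 D))

  better? : ∀ X D → Better X D
  better? X D with dominates X in p | minus (plus 0 D) X in q
  ... | false | k     = kept (cong (λ b → choose b (minus (plus 0 D) X) X D) p) (λ t → ⊥-elim (subst T p t))
  ... | true  | zero  = kept (cong₂ (λ b k → choose b k X D) p q)
    (λ _ → m∸n≡0⇒m≤n (trans (sym (minus-plus X D)) q))
  ... | true  | suc k = replaced (cong₂ (λ b k → choose b k X D) p q) (subst T (sym p) tt)
    (m∸n≢0⇒n<m λ r → 0≢1+n (trans (sym r) (trans (sym (minus-plus X D)) q)))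

  better-≤ : ∀ X D → #true (better X D) ≤ #true D
  better-≤ X D with better? X D
  ... | kept p _       rewrite p = ≤-refl
  ... | replaced p _ q rewrite p = <⇒≤ q

  best-≤ : ∀ C D → #true (best C D) ≤ #true D
  best-≤ []      D = ≤-refl
  best-≤ (X ∷ C) D = ≤-trans (best-≤ C _) (better-≤ X D)

  best-minimal : ∀ C D {X} → X ∈ˡ C → T (dominates X) → #true (best C D) ≤ #true X
  best-minimal (X ∷ C) D (there p)   t = best-minimal C _ p t
  best-minimal (X ∷ C) D (here refl) t with better? X D
  ... | kept p q       rewrite p = ≤-trans (best-≤ C D) (q t)
  ... | replaced p _ q rewrite p = best-≤ C X

  best-dominates : ∀ C D → T (dominates D) → T (dominates (best C D))
  best-dominates []      D t = t
  best-dominates (X ∷ C) D t with better? X D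
  ... | kept p _       rewrite p = best-dominates C D t
  ... | replaced p s _ rewrite p = best-dominates C X s

  -- Ties are never resolved in favour of the candidate. Thus the size is a strict measure for the
  -- rounds, which cannot cycle among sets of equal size.
  best-fixed-or-< : ∀ C D → best C D ≡ D ⊎ #true (best C D) < #true D
  best-fixed-or-< []      D = inj₁ refl
  best-fixed-or-< (X ∷ C) D with better? X D
  ... | kept p _       rewrite p = best-fixed-or-< C D
  ... | replaced p _ q rewrite p = inj₂ (≤-<-trans (best-≤ C X) q)

  module _ (K : ℕ) where

    LocallyOptimal : List Bool → Set
    LocallyOptimal D = ∀ {k X} → k ≤ K → Differ k D X → T (dominates X) → #true D ≤ #true X

    rounds-fixed : ∀ k D → improve K adj D ≡ D → rounds K adj k D ≡ D
    rounds-fixed zero    D p = refl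
    rounds-fixed (suc k) D p rewrite p = rounds-fixed k D p

    -- `k` bounds both the size and the number of rounds left. Either a round shrinks the set, or it
    -- is a fixed point from then on; when no rounds are left, the set is empty.
    rounds-locallyOptimal : ∀ k D → #true D ≤ k → LocallyOptimal (rounds K adj k D)
    rounds-locallyOptimal zero    D p _ _ _ = ≤-trans p z≤n
    rounds-locallyOptimal (suc k) D p with best-fixed-or-< (expandN K (D ∷ [])) D
    ... | inj₂ q = rounds-locallyOptimal k _ (s≤s⁻¹ (≤-trans q p))
    -- At a fixed point `D` is itself the result of the selection, hence no larger than any
    -- dominating candidate.
    ... | inj₁ q = subst LocallyOptimal (sym (rounds-fixed (suc k) D q)) λ l d t →
      subst (λ E → #true E ≤ _) q (best-minimal _ D (expandN-complete K (D ∷ []) l (here refl) d) t)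

    rounds-dominates : ∀ k D → T (dominates D) → T (dominates (rounds K adj k D))
    rounds-dominates zero    D t = t
    rounds-dominates (suc k) D t = rounds-dominates k _ (best-dominates (expandN K (D ∷ [])) D t)

    length-rounds : ∀ k D → length D ≡ n → length (rounds K adj k D) ≡ n
    length-rounds zero    D p = p
    length-rounds (suc k) D p = length-rounds k _ (length-improve K adj D p)

-- Counting

ι : {P : Set} → Dec P → ℕ
ι p? = if does p? then 1 else 0

module _ where

  private variable
    P Q R S : Set
    n : ℕ
    A B C D : Fin n → Set

  ι-mono : (p? : Dec P) (q? : Dec Q) → (P → Q) → ι p? ≤ ι q?
  ι-mono (no _)  q?      f = z≤n
  ι-mono (yes p) (yes q) f = ≤-refl
  ι-mono (yes p) (no ¬q) f = ⊥-elim (¬q (f p))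

  ι-⊎ : (p? : Dec P) (q? : Dec Q) (r? : Dec R) → (P → Q ⊎ R) → ι p? ≤ ι q? + ι r?
  ι-⊎ (no _)  q?      r?      f = z≤n
  ι-⊎ (yes p) (yes q) r?      f = s≤s z≤n
  ι-⊎ (yes p) (no ¬q) (yes r) f = ≤-refl
  ι-⊎ (yes p) (no ¬q) (no ¬r) f = ⊥-elim ([ ¬q , ¬r ]′ (f p))

  ι-× : (p? : Dec P) (q? : Dec Q) (r? : Dec R) (s? : Dec S) →
        (P → R) → (Q → R) → (P → Q → S) → ι p? + ι q? ≤ ι r? + ι s?
  ι-× (no _)  q?      r?      s? f g h = ≤-trans (ι-mono q? r? g) (m≤m+n (ι r?) (ι s?))
  ι-× (yes p) (no _)  r?      s? f g h = ≤-trans (ι-mono (yes p) r? f) (m≤m+n (ι r?) (ι s?))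
  ι-× (yes p) (yes q) (yes r) (yes s) f g h = ≤-refl
  ι-× (yes p) (yes q) (no ¬r) s?      f g h = ⊥-elim (¬r (f p))
  ι-× (yes p) (yes q) (yes r) (no ¬s) f g h = ⊥-elim (¬s (h p q))

  sum-mono : {f g : Fin n → ℕ} → (∀ i → f i ≤ g i) → sum f ≤ sum g
  sum-mono {zero}  p = z≤n
  sum-mono {suc n} p = +-mono-≤ (p Fin.zero) (sum-mono (p ∘ Fin.suc))

  term≤sum : (f : Fin n → ℕ) (i : Fin n) → f i ≤ sum f
  term≤sum f Fin.zero    = m≤m+n _ _
  term≤sum f (Fin.suc i) = ≤-trans (term≤sum (f ∘ Fin.suc) i) (m≤n+m _ _)

  sum-zero : {f : Fin n → ℕ} → (∀ i → f i ≡ 0) → sum f ≡ 0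
  sum-zero {zero}  p = refl
  sum-zero {suc n} p = cong₂ _+_ (p Fin.zero) (sum-zero (p ∘ Fin.suc))

  sum-const : ∀ n k → sum {n} (λ _ → k) ≡ n * k
  sum-const zero    k = refl
  sum-const (suc n) k = cong (k +_) (sum-const n k)

  sum-single : (f : Fin n → ℕ) (i : Fin n) → (∀ j → i ≢ j → f j ≡ 0) → sum f ≡ f i
  sum-single f Fin.zero    p = trans (cong (f Fin.zero +_) (sum-zero λ j → p (Fin.suc j) λ ())) (+-identityʳ _)
  sum-single f (Fin.suc i) p = cong₂ _+_ (p Fin.zero λ ())
    (sum-single (f ∘ Fin.suc) i λ j i≢j → p (Fin.suc j) λ { refl → i≢j refl })

  +-interchange : ∀ a b c d → (a + b) + (c + d) ≡ (a + c) + (b + d)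
  +-interchange = solve-∀

  # : {A : Fin n → Set} → (∀ v → Dec (A v)) → ℕ
  # A? = sum (λ v → ι (A? v))

  #-mono : (A? : ∀ v → Dec (A v)) (B? : ∀ v → Dec (B v)) → (∀ v → A v → B v) → # A? ≤ # B?
  #-mono A? B? f = sum-mono λ v → ι-mono (A? v) (B? v) (f v)

  #-⊎ : (A? : ∀ v → Dec (A v)) (B? : ∀ v → Dec (B v)) (C? : ∀ v → Dec (C v)) →
        (∀ v → A v → B v ⊎ C v) → # A? ≤ # B? + # C?
  #-⊎ A? B? C? f = ≤-trans (sum-mono λ v → ι-⊎ (A? v) (B? v) (C? v) (f v))
    (≤-reflexive (∑-distrib-+ (λ v → ι (B? v)) (λ v → ι (C? v))))

  -- Inclusion and exclusion, with `C` any superset of the union and `D` any superset of the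
  -- intersection.
  #-× : (A? : ∀ v → Dec (A v)) (B? : ∀ v → Dec (B v)) (C? : ∀ v → Dec (C v)) (D? : ∀ v → Dec (D v)) →
        (∀ v → A v → C v) → (∀ v → B v → C v) → (∀ v → A v → B v → D v) → # A? + # B? ≤ # C? + # D?
  #-× A? B? C? D? f g h = subst₂ _≤_ (∑-distrib-+ (λ v → ι (A? v)) (λ v → ι (B? v)))
    (∑-distrib-+ (λ v → ι (C? v)) (λ v → ι (D? v)))
    (sum-mono λ v → ι-× (A? v) (B? v) (C? v) (D? v) (f v) (g v) (h v))

  -- Double counting of the pairs with `B v` and `f v ≡ u`: each `u` in `A` has at least one
  -- partner, each `v` at most one.
  #-image : ∀ {m n} {A : Fin m → Set} {B : Fin n → Set}
    (A? : ∀ u → Dec (A u)) (B? : ∀ v → Dec (B v)) (f : Fin n → Fin m) →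
    (∀ u → A u → ∃[ v ] B v × f v ≡ u) → # A? ≤ # B?
  #-image A? B? f onto = begin
    sum (λ u → ι (A? u))                            ≤⟨ sum-mono member ⟩
    sum (λ u → sum (λ v → ι (B? v ×-dec f v ≟ᶠ u)))  ≡⟨ ∑-comm (λ u v → ι (B? v ×-dec f v ≟ᶠ u)) ⟩
    sum (λ v → sum (λ u → ι (B? v ×-dec f v ≟ᶠ u)))  ≤⟨ sum-mono fibre ⟩
    sum (λ v → ι (B? v))                            ∎
    where
    open ≤-Reasoning
    absent : (p? : Dec P) → ¬ P → ι p? ≡ 0
    absent (yes p) ¬p = ⊥-elim (¬p p)
    absent (no _)  ¬p = refl
    member : ∀ u → ι (A? u) ≤ sum (λ v → ι (B? v ×-dec f v ≟ᶠ u))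
    member u with A? u
    ... | no _  = z≤n
    ... | yes a = let v , b , p = onto u a in
      ≤-trans (ι-mono (yes a) (B? v ×-dec f v ≟ᶠ u) λ _ → b , p) (term≤sum (λ v → ι (B? v ×-dec f v ≟ᶠ u)) v)
    fibre : ∀ v → sum (λ u → ι (B? v ×-dec f v ≟ᶠ u)) ≤ ι (B? v)
    fibre v = ≤-trans (≤-reflexive (sum-single (λ u → ι (B? v ×-dec f v ≟ᶠ u)) (f v) λ u p →
      absent (B? v ×-dec f v ≟ᶠ u) (p ∘ proj₂))) (ι-mono (B? v ×-dec f v ≟ᶠ f v) (B? v) proj₁)

-- Cutting a slab along rows

module Sweep {n : ℕ} (L O : Fin n → Set) (l o : Fin n → Fin n) (loᴸ hiᴸ loᴼ hiᴼ : Fin n → ℕ)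
  (loᴸ≤hiᴸ : ∀ v → loᴸ v ≤ hiᴸ v) (loᴼ≤hiᴼ : ∀ v → loᴼ v ≤ hiᴼ v)
  (meetᴸᴼ : ∀ v → loᴸ (l v) ≤ hiᴼ (o v)) (meetᴼᴸ : ∀ v → loᴼ (o v) ≤ hiᴸ (l v))
  (r p : ℕ)
  (exchange : ∀ {A B : Fin n → Set} (A? : ∀ v → Dec (A v)) (B? : ∀ v → Dec (B v)) →
    (∀ v → A v → L v) → (∀ v → B v → O v) → (∀ v → A (l v) → B (o v)) →
    # A? + # B? ≤ suc r + (p + p) → # A? ≤ # B?)
  where

  module Cut {A B : Fin n → Set} (A? : ∀ v → Dec (A v)) (B? : ∀ v → Dec (B v)) where

    rowᴸ? : ∀ h v → Dec (A v × (loᴸ v ≤ h × h ≤ hiᴸ v))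
    rowᴸ? h v = A? v ×-dec (loᴸ v ≤? h ×-dec h ≤? hiᴸ v)

    rowᴼ? : ∀ h v → Dec (B v × (loᴼ v ≤ h × h ≤ hiᴼ v))
    rowᴼ? h v = B? v ×-dec (loᴼ v ≤? h ×-dec h ≤? hiᴼ v)

    Thin : Set
    Thin = ∀ h → # (rowᴸ? h) + # (rowᴼ? h) ≤ p

    startedᴸ? : ∀ h v → Dec (A v × loᴸ v ≤ h)
    startedᴸ? h v = A? v ×-dec loᴸ v ≤? h

    startedᴼ? : ∀ h v → Dec (B v × loᴼ v ≤ h)
    startedᴼ? h v = B? v ×-dec loᴼ v ≤? h

    started : ℕ → ℕ
    started h = # (startedᴸ? h) + # (startedᴼ? h)

    started-suc : Thin → ∀ h → started (suc h) ≤ started h + p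
    started-suc thin h = begin
      # (startedᴸ? (suc h)) + # (startedᴼ? (suc h))
        ≤⟨ +-mono-≤ (#-⊎ (startedᴸ? (suc h)) (startedᴸ? h) (rowᴸ? (suc h)) (λ v → split (loᴸ≤hiᴸ v)))
                    (#-⊎ (startedᴼ? (suc h)) (startedᴼ? h) (rowᴼ? (suc h)) (λ v → split (loᴼ≤hiᴼ v))) ⟩
      (# (startedᴸ? h) + # (rowᴸ? (suc h))) + (# (startedᴼ? h) + # (rowᴼ? (suc h)))
        ≡⟨ +-interchange (# (startedᴸ? h)) _ _ _ ⟩
      started h + (# (rowᴸ? (suc h)) + # (rowᴼ? (suc h)))
        ≤⟨ +-monoʳ-≤ (started h) (thin (suc h)) ⟩
      started h + p ∎
      where
      open ≤-Reasoning
      split : ∀ {X : Set} {lo hi : ℕ} → lo ≤ hi → X × lo ≤ suc h → (X × lo ≤ h) ⊎ (X × (lo ≤ suc h × suc h ≤ hi))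
      split lo≤hi (x , q) =
        [ (λ lo<1+h → inj₁ (x , s≤s⁻¹ lo<1+h)) , (λ { refl → inj₂ (x , q , lo≤hi) }) ]′ (m≤n⇒m<n∨m≡n q)

    -- An interval that starts in a row also meets it, so `started` grows by at most `p` per row and
    -- overshoots the threshold `suc r + p` by at most `p` when it first reaches it.
    cut-below : Thin → ∀ h → started h < suc r + p ⊎ ∃[ k ] suc r + p ≤ started k × started k ≤ suc r + (p + p)
    cut-below thin zero = inj₁ (s≤s (≤-trans
      (+-mono-≤ (#-mono (startedᴸ? 0) (rowᴸ? 0) λ _ (a , q) → a , q , z≤n)
                (#-mono (startedᴼ? 0) (rowᴼ? 0) λ _ (b , q) → b , q , z≤n))
      (≤-trans (thin 0) (m≤n+m p r))))
    cut-below thin (suc h) with cut-below thin h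
    ... | inj₂ found = inj₂ found
    ... | inj₁ early with started (suc h) <? suc r + p
    ...   | yes q = inj₁ q
    ...   | no ¬q = inj₂ (suc h , ≮⇒≥ ¬q , (begin
      started (suc h)    ≤⟨ started-suc thin h ⟩
      started h + p      ≤⟨ +-monoˡ-≤ p (<⇒≤ early) ⟩
      suc r + p + p      ≡⟨ +-assoc (suc r) p p ⟩
      suc r + (p + p)    ∎))
      where open ≤-Reasoning

    cut : Thin → # A? + # B? ≰ suc r + (p + p) → ∃[ h ] suc r + p ≤ started h × started h ≤ suc r + (p + p)
    -- By this row every interval has started.
    cut thin big with cut-below thin (sum loᴸ + sum loᴼ)
    ... | inj₂ found = found
    ... | inj₁ early = ⊥-elim (big (≤-trans
      (+-mono-≤ (#-mono A? (startedᴸ? _) λ v a → a , ≤-trans (term≤sum loᴸ v) (m≤m+n _ _))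
                (#-mono B? (startedᴼ? _) λ v b → b , ≤-trans (term≤sum loᴼ v) (m≤n+m _ _)))
      (≤-trans (<⇒≤ early) (+-monoʳ-≤ (suc r) (m≤m+n p p)))))

  open Cut

  -- Amortization of one cut. Index 1 stands for the part exchanged at once, x for what crosses the
  -- cut, 2 for the recursion. The loss `s * p` of the cut is paid for by the term `p * (a + b)`,
  -- because at least `s` members do not enter the recursion.
  combine : ∀ {a b a₁ aₓ a₂ b₁ bₓ b₂ s} → a ≤ a₁ + aₓ + a₂ → a₁ ≤ b₁ → b₁ + b₂ ≤ b + bₓ → aₓ + bₓ ≤ p →
    a₂ + b₂ + s ≤ a + b → s * a₂ ≤ s * b₂ + p * (a₂ + b₂) → s * a ≤ s * b + p * (a + b)
  combine {a} {b} {a₁} {aₓ} {a₂} {b₁} {bₓ} {b₂} {s} a≤ a₁≤b₁ b≤ aₓ+bₓ≤p fewer rec = begin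
    s * a                                          ≤⟨ *-monoʳ-≤ s (≤-trans a≤ (+-monoˡ-≤ a₂ (+-monoˡ-≤ aₓ a₁≤b₁))) ⟩
    s * (b₁ + aₓ + a₂)                             ≡⟨ e₁ s b₁ aₓ a₂ ⟩
    s * (b₁ + aₓ) + s * a₂                         ≤⟨ +-monoʳ-≤ (s * (b₁ + aₓ)) rec ⟩
    s * (b₁ + aₓ) + (s * b₂ + p * (a₂ + b₂))       ≡⟨ e₂ s b₁ aₓ b₂ (p * (a₂ + b₂)) ⟩
    s * (b₁ + b₂) + (s * aₓ + p * (a₂ + b₂))       ≤⟨ +-monoˡ-≤ _ (*-monoʳ-≤ s b≤) ⟩
    s * (b + bₓ) + (s * aₓ + p * (a₂ + b₂))        ≡⟨ e₃ s b bₓ aₓ (p * (a₂ + b₂)) ⟩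
    s * b + (s * (aₓ + bₓ) + p * (a₂ + b₂))        ≤⟨ +-monoʳ-≤ (s * b) (+-monoˡ-≤ _ (*-monoʳ-≤ s aₓ+bₓ≤p)) ⟩
    s * b + (s * p + p * (a₂ + b₂))                ≡⟨ e₄ s b p (a₂ + b₂) ⟩
    s * b + p * (a₂ + b₂ + s)                      ≤⟨ +-monoʳ-≤ (s * b) (*-monoʳ-≤ p fewer) ⟩
    s * b + p * (a + b)                            ∎
    where
    open ≤-Reasoning
    e₁ : ∀ s x y z → s * (x + y + z) ≡ s * (x + y) + s * z
    e₁ = solve-∀
    e₂ : ∀ s x y z w → s * (x + y) + (s * z + w) ≡ s * (x + z) + (s * y + w)
    e₂ = solve-∀
    e₃ : ∀ s x y z w → s * (x + y) + (s * z + w) ≡ s * x + (s * (z + y) + w)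
    e₃ = solve-∀
    e₄ : ∀ s x y z → s * x + (s * y + y * z) ≡ s * x + y * (z + s)
    e₄ = solve-∀

  -- Strictly below the cut everything is exchanged at once, strictly
  -- above it by recursion; the members of A crossing it are given up,
  -- the members of B crossing it are counted twice.
  sweep : ∀ fuel {A B : Fin n → Set} (A? : ∀ v → Dec (A v)) (B? : ∀ v → Dec (B v)) →
    (∀ v → A v → L v) → (∀ v → B v → O v) → (∀ v → A (l v) → B (o v)) → Thin A? B? →
    # A? + # B? ≤ fuel → suc r * # A? ≤ suc r * # B? + p * (# A? + # B?)
  sweep fuel A? B? A⊆L B⊆O closed thin bound with # A? + # B? ≤? suc r + (p + p)
  sweep fuel A? B? A⊆L B⊆O closed thin bound | yes small =
    ≤-trans (*-monoʳ-≤ (suc r) (exchange A? B? A⊆L B⊆O closed small)) (m≤m+n _ _)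
  sweep zero A? B? A⊆L B⊆O closed thin bound | no big = ⊥-elim (big (≤-trans bound z≤n))
  sweep (suc fuel) {A} {B} A? B? A⊆L B⊆O closed thin bound | no big with cut A? B? thin big
  ... | h , late , soon = combine {aₓ = # (rowᴸ? A? B? h)} {bₓ = # (rowᴼ? A? B? h)} {s = suc r}
    (≤-trans (#-⊎ A? (startedᴸ? A? B? h) aboveᴸ? λ v a →
               [ (λ q → inj₁ (a , q)) , (λ q → inj₂ (a , q)) ]′ (≤-<-connex (loᴸ v) h))
             (+-monoˡ-≤ (# aboveᴸ?) (#-⊎ (startedᴸ? A? B? h) belowᴸ? (rowᴸ? A? B? h) λ v (a , q) →
               [ (λ q′ → inj₂ (a , q , q′)) , (λ q′ → inj₁ (a , q′)) ]′ (≤-<-connex h (hiᴸ v)))))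
    (exchange belowᴸ? (startedᴼ? A? B? h) (λ v (a , _) → A⊆L v a) (λ v (b , _) → B⊆O v b)
      -- If `l v` ends below the cut, then `o v`, whose interval meets that of `l v`, has started by
      -- the cut.
      (λ v (a , q) → closed v a , ≤-trans (meetᴼᴸ v) (<⇒≤ q))
      (≤-trans (+-monoˡ-≤ _ (#-mono belowᴸ? (startedᴸ? A? B? h) λ v (a , q) → a , ≤-trans (loᴸ≤hiᴸ v) (<⇒≤ q))) soon))
    (#-× (startedᴼ? A? B? h) aboveᴼ? B? (rowᴼ? A? B? h) (λ _ → proj₁) (λ _ → proj₁) crossᴼ)
    (thin h) fewer
    (sweep fuel aboveᴸ? aboveᴼ? (λ v (a , _) → A⊆L v a) (λ v (b , _) → B⊆O v b)
      (λ v (a , q) → closed v a , <-≤-trans q (meetᴸᴼ v))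
      (λ k → ≤-trans (+-mono-≤ (#-mono (rowᴸ? aboveᴸ? aboveᴼ? k) (rowᴸ? A? B? k) λ _ ((a , _) , q) → a , q)
                               (#-mono (rowᴼ? aboveᴸ? aboveᴼ? k) (rowᴼ? A? B? k) λ _ ((b , _) , q) → b , q)) (thin k))
      (s≤s⁻¹ (≤-trans (s≤s (m≤m+n above r)) (≤-trans (≤-reflexive (sym (+-suc above r))) (≤-trans fewer bound)))))
    where
    belowᴸ? : ∀ v → Dec (A v × hiᴸ v < h)
    belowᴸ? v = A? v ×-dec hiᴸ v <? h
    aboveᴸ? : ∀ v → Dec (A v × h < loᴸ v)
    aboveᴸ? v = A? v ×-dec h <? loᴸ v
    aboveᴼ? : ∀ v → Dec (B v × h < hiᴼ v)
    aboveᴼ? v = B? v ×-dec h <? hiᴼ v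
    above : ℕ
    above = # aboveᴸ? + # aboveᴼ?
    crossᴼ : ∀ v → B v × loᴼ v ≤ h → B v × h < hiᴼ v → B v × (loᴼ v ≤ h × h ≤ hiᴼ v)
    crossᴼ v (b , q) (_ , q′) = b , q , <⇒≤ q′
    -- Only crossing members are both started and left for the recursion, and there are at most `p`
    -- of them; the surplus `p` in the threshold of the cut makes up for this.
    fewer : above + suc r ≤ # A? + # B?
    fewer = +-cancelʳ-≤ p _ _ (begin
      above + suc r + p                ≡⟨ +-assoc above (suc r) p ⟩
      above + (suc r + p)              ≤⟨ +-monoʳ-≤ above late ⟩
      above + started A? B? h          ≡⟨ +-comm above _ ⟩
      started A? B? h + above          ≡⟨ +-interchange (# (startedᴸ? A? B? h)) _ _ _ ⟩
      (# (startedᴸ? A? B? h) + # aboveᴸ?) + (# (startedᴼ? A? B? h) + # aboveᴼ?)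
        ≤⟨ +-mono-≤ (#-× (startedᴸ? A? B? h) aboveᴸ? A? (rowᴸ? A? B? h) (λ _ → proj₁) (λ _ → proj₁)
                         (λ v (_ , q) (_ , q′) → ⊥-elim (<⇒≱ q′ q)))
                    (#-× (startedᴼ? A? B? h) aboveᴼ? B? (rowᴼ? A? B? h) (λ _ → proj₁) (λ _ → proj₁) crossᴼ) ⟩
      (# A? + # (rowᴸ? A? B? h)) + (# B? + # (rowᴼ? A? B? h))   ≡⟨ +-interchange (# A?) _ _ _ ⟩
      (# A? + # B?) + (# (rowᴸ? A? B? h) + # (rowᴼ? A? B? h))   ≤⟨ +-monoʳ-≤ (# A? + # B?) (thin h) ⟩
      # A? + # B? + p                  ∎)
      where open ≤-Reasoning

-- Slabs

-- What the analysis retains of the paths: a left end and an interval of rows. In `sparse`, a path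
-- that starts among `w` columns stays among `w + c` columns, and `d` bounds the number of paths
-- through a point.
record Layout (n c d : ℕ) : Set where
  field
    col lo hi : Fin n → ℕ
    lo≤hi     : ∀ v → lo v ≤ hi v
    sparse    : ∀ h a w →
      # (λ v → (lo v ≤? h ×-dec h ≤? hi v) ×-dec (a ≤? col v ×-dec col v <? a + w)) ≤ (w + c) * d

  Near : Fin n → Fin n → Set
  Near u v = (lo u ≤ hi v × lo v ≤ hi u) × (col u ≤ col v + c × col v ≤ col u + c)

module Blob {n c d : ℕ} (Λ : Layout n c d) (f : Fin n → Fin n) (near : ∀ v → Layout.Near Λ v (f v)) where
  open Layout Λ

  fibre : Fin n → List (Fin n)
  fibre u = filter (λ v → f v ≟ᶠ u) (allFin n)

  -- The default `u` lies in its own fibre if `f u ≡ u`, and only such `u` are counted below.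
  lowest highest : Fin n → Fin n
  lowest  u = argmin lo u (fibre u)
  highest u = argmax hi u (fibre u)

  bottom top : Fin n → ℕ
  bottom u = lo (lowest u)
  top    u = hi (highest u)

  bottom≤lo : ∀ v → bottom (f v) ≤ lo v
  bottom≤lo v = All.lookup (f[argmin]≤f[xs] {f = lo} (f v) (fibre (f v)))
    (∈-filter⁺ (λ w → f w ≟ᶠ f v) (∈-allFin v) refl)

  hi≤top : ∀ v → hi v ≤ top (f v)
  hi≤top v = All.lookup (f[xs]≤f[argmax] {f = hi} (f v) (fibre (f v)))
    (∈-filter⁺ (λ w → f w ≟ᶠ f v) (∈-allFin v) refl)

  bottom≤top : ∀ u → bottom u ≤ top u
  bottom≤top u = ≤-trans
    (f[argmin]≤f[⊤] {f = lo} u (fibre u)) (≤-trans (lo≤hi u) (f[⊥]≤f[argmax] {f = hi} u (fibre u)))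

  -- All intervals of a fibre meet the one of its centre, so their union
  -- is an interval.
  row : ∀ {u h} → f u ≡ u → bottom u ≤ h → h ≤ top u → ∃[ v ] (lo v ≤ h × h ≤ hi v) × f v ≡ u
  row {u} {h} fixed p q with ≤-<-connex (lo u) h | ≤-<-connex h (hi u)
  ... | inj₁ r | inj₁ s = u , (r , s) , fixed
  ... | inj₁ r | inj₂ s = highest u , (≤-trans meets (<⇒≤ s) , q) , in-fibre
    where
    in-fibre : f (highest u) ≡ u
    in-fibre = [ (λ e → trans (cong f e) fixed) , proj₂ ∘ ∈-filter⁻ (λ w → f w ≟ᶠ u) {xs = allFin n} ]′
      (argmax-sel hi u (fibre u))
    meets : lo (highest u) ≤ hi u
    meets = proj₁ (proj₁ (subst (Near (highest u)) in-fibre (near (highest u))))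
  ... | inj₂ r | _      = lowest u , (p , ≤-trans (<⇒≤ r) meets) , in-fibre
    where
    in-fibre : f (lowest u) ≡ u
    in-fibre = [ (λ e → trans (cong f e) fixed) , proj₂ ∘ ∈-filter⁻ (λ w → f w ≟ᶠ u) {xs = allFin n} ]′
      (argmin-sel lo u (fibre u))
    meets : lo u ≤ hi (lowest u)
    meets = proj₂ (proj₁ (subst (Near (lowest u)) in-fibre (near (lowest u))))

  -- Each counted `u` is `f v` for some `v` whose own interval contains `h`, so it suffices to count
  -- such `v`. Their columns are within `c` of that of `u`, which widens the window by `c` on both
  -- sides; the last `c` comes from `sparse`. If `a ∸ (k + c)` truncates, the window merely extends
  -- further to the right.
  blob-sparse : {A : Fin n → Set} (A? : ∀ v → Dec (A v)) → (∀ v → A v → f v ≡ v) → ∀ k a w →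
    (∀ v → A v → a ≤ col v + k × col v + k < a + w) →
    ∀ h → # (λ v → A? v ×-dec (bottom v ≤? h ×-dec h ≤? top v)) ≤ (w + (c + c) + c) * d
  blob-sparse {A} A? fixed k a w window h =
    ≤-trans (#-image (λ u → A? u ×-dec (bottom u ≤? h ×-dec h ≤? top u))
      (λ v → (lo v ≤? h ×-dec h ≤? hi v)
             ×-dec (a ∸ (k + c) ≤? col v ×-dec col v <? a ∸ (k + c) + (w + (c + c)))) f onto)
       (sparse h (a ∸ (k + c)) (w + (c + c)))
    where
    open ≤-Reasoning
    e₁ : ∀ x k c → x + c + k ≡ k + c + x
    e₁ = solve-∀
    e₂ : ∀ x k c → x + c + (k + c) ≡ x + k + (c + c)
    e₂ = solve-∀
    e₃ : ∀ x k w c → k + x + w + (c + c) ≡ x + (w + (c + c)) + k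
    e₃ = solve-∀
    onto : ∀ u → A u × (bottom u ≤ h × h ≤ top u) →
      ∃[ v ] ((lo v ≤ h × h ≤ hi v) × (a ∸ (k + c) ≤ col v × col v < a ∸ (k + c) + (w + (c + c)))) × f v ≡ u
    onto u (α , p , q) with row (fixed u α) p q
    ... | v , rows , refl = v , (rows , m≤n+o⇒m∸n≤o a (k + c) left-end , +-cancelʳ-< (k + c) _ _ right-end) , refl
      where
      left-end : a ≤ k + c + col v
      left-end = begin
        a                ≤⟨ proj₁ (window _ α) ⟩
        col (f v) + k    ≤⟨ +-monoˡ-≤ k (proj₂ (proj₂ (near v))) ⟩
        col v + c + k    ≡⟨ e₁ (col v) k c ⟩
        k + c + col v    ∎
      right-end : col v + (k + c) < a ∸ (k + c) + (w + (c + c)) + (k + c)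
      right-end = begin-strict
        col v + (k + c)                          ≤⟨ +-monoˡ-≤ (k + c) (proj₁ (proj₂ (near v))) ⟩
        col (f v) + c + (k + c)                  ≡⟨ e₂ (col (f v)) k c ⟩
        col (f v) + k + (c + c)                  <⟨ +-monoˡ-< (c + c) (proj₂ (window _ α)) ⟩
        a + w + (c + c)                          ≤⟨ +-monoˡ-≤ (c + c) (+-monoˡ-≤ w (m≤n+m∸n a (k + c))) ⟩
        k + c + (a ∸ (k + c)) + w + (c + c)      ≡⟨ e₃ (a ∸ (k + c)) (k + c) w c ⟩
        a ∸ (k + c) + (w + (c + c)) + (k + c)    ∎

-- Floor sums over all shifts

module _ (W : ℕ) .{{_ : NonZero W}} where

  m<[m/W]*W+W : ∀ m → m < m / W * W + W
  m<[m/W]*W+W m = begin-strict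
    m                    ≡⟨ m≡m%n+[m/n]*n m W ⟩
    m % W + m / W * W    <⟨ +-monoˡ-< (m / W * W) (m%n<n m W) ⟩
    W + m / W * W        ≡⟨ +-comm W _ ⟩
    m / W * W + W        ∎
    where open ≤-Reasoning

  -- The sum in Hermite's identity, whose value is `x`; only its increments are needed.
  floors : ℕ → ℕ
  floors x = sum {W} λ j → (x + toℕ j) / W

  sum-shift : ∀ m (g : ℕ → ℕ) → g 0 + sum {m} (λ j → g (suc (toℕ j))) ≡ sum {m} (g ∘ toℕ) + g m
  sum-shift zero    g = +-identityʳ (g 0)
  sum-shift (suc m) g = trans (cong (g 0 +_) (sum-shift m (g ∘ suc))) (sym (+-assoc (g 0) _ (g (suc m))))

  -- Passing to `suc x` shifts the summands by one place: `x / W` leaves and `(x + W) / W` enters.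
  floors-suc : ∀ x → floors (suc x) ≡ suc (floors x)
  floors-suc x = +-cancelˡ-≡ (x / W) _ _ (begin
    x / W + floors (suc x)
      ≡⟨ cong₂ _+_ (/-congˡ (sym (+-identityʳ x))) (sum-cong-≗ {W} λ j → /-congˡ (sym (+-suc x (toℕ j)))) ⟩
    g 0 + sum {W} (λ j → g (suc (toℕ j)))
      ≡⟨ sum-shift W g ⟩
    floors x + (x + W) / W
      ≡⟨ cong (floors x +_) (trans (+-distrib-/-∣ʳ x ∣-refl) (cong (x / W +_) (n/n≡1 W))) ⟩
    floors x + (x / W + 1)
      ≡⟨ e (floors x) (x / W) ⟩
    x / W + suc (floors x)   ∎)
    where
    open ≡-Reasoning
    g : ℕ → ℕ
    g k = (x + k) / W
    e : ∀ a b → a + (b + 1) ≡ b + suc a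
    e = solve-∀

  floors-+ : ∀ k x → floors (k + x) ≡ k + floors x
  floors-+ zero    x = refl
  floors-+ (suc k) x = trans (floors-suc (k + x)) (cong suc (floors-+ k x))

interval-count : ∀ m α β → α ≤ β → sum {m} (λ i → ι (α ≤? toℕ i ×-dec toℕ i <? β)) + α ≤ β
interval-count zero    α       β       p = p
interval-count (suc m) zero    zero    p = ≤-trans (+-monoˡ-≤ 0 (sum-mono {m} λ i →
  ι-mono (0 ≤? suc (toℕ i) ×-dec suc (toℕ i) <? 0) (0 ≤? toℕ i ×-dec toℕ i <? 0) λ ()))
  (interval-count m 0 0 z≤n)
interval-count (suc m) zero    (suc β) p = s≤s (≤-trans (+-monoˡ-≤ 0 (sum-mono {m} λ i →
  ι-mono (0 ≤? suc (toℕ i) ×-dec suc (toℕ i) <? suc β) (0 ≤? toℕ i ×-dec toℕ i <? β) λ (_ , q) → z≤n , s≤s⁻¹ q))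
  (interval-count m 0 β z≤n))
interval-count (suc m) (suc α) (suc β) (s≤s p) =
  ≤-trans (≤-reflexive (+-suc _ α)) (s≤s (≤-trans (+-monoˡ-≤ α (sum-mono {m} λ i →
  ι-mono (suc α ≤? suc (toℕ i) ×-dec suc (toℕ i) <? suc β) (α ≤? toℕ i ×-dec toℕ i <? β)
    λ (q , q′) → s≤s⁻¹ q , s≤s⁻¹ q′))
  (interval-count m α β p)))

swap₃ : ∀ {k m n} (f : Fin k → Fin m → Fin n → ℕ) →
  sum (λ j → sum (λ i → sum (f j i))) ≡ sum (λ v → sum (λ j → sum (λ i → f j i v)))
swap₃ {k} f = trans (sum-cong-≗ {k} λ j → ∑-comm (f j)) (∑-comm (λ j v → sum (λ i → f j i v)))

-- Averaging over the shifted divisions into slabs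

module Compare {n c d : ℕ} (Λ : Layout n c d) (L O : Fin n → Set) (L? : ∀ v → Dec (L v)) (O? : ∀ v → Dec (O v))
  (l o : Fin n → Fin n) (l∈L : ∀ v → L (l v)) (o∈O : ∀ v → O (o v))
  (l-fixed : ∀ v → L v → l v ≡ v) (o-fixed : ∀ v → O v → o v ≡ v)
  (near-l : ∀ v → Layout.Near Λ v (l v)) (near-o : ∀ v → Layout.Near Λ v (o v))
  (W r p : ℕ) .{{_ : NonZero W}}
  (p-large : (W + (c + c) + c) * d + (W + ((c + c) + (c + c)) + (c + c) + c) * d ≤ p)
  (exchange : ∀ {A B : Fin n → Set} (A? : ∀ v → Dec (A v)) (B? : ∀ v → Dec (B v)) →
    (∀ v → A v → L v) → (∀ v → B v → O v) → (∀ v → A (l v) → B (o v)) →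
    # A? + # B? ≤ suc (r + p) + (p + p) → # A? ≤ # B?)
  where

  open Layout Λ
  private
    module BL = Blob Λ l near-l
    module BO = Blob Λ o near-o

  g : ℕ
  g = c + c

  open Sweep L O l o BL.bottom BL.top BO.bottom BO.top BL.bottom≤top BO.bottom≤top
    (λ v → ≤-trans (BL.bottom≤lo v) (≤-trans (lo≤hi v) (BO.hi≤top v)))
    (λ v → ≤-trans (BO.bottom≤lo v) (≤-trans (lo≤hi v) (BL.hi≤top v)))
    (r + p) p exchange

  module _ (j i : ℕ) where

    A? : ∀ v → Dec (L v × (col v + (g + j)) / W ≡ i)
    A? v = L? v ×-dec (col v + (g + j)) / W ≟ i

    -- These are the members of O within `g` columns of slab `i`. The offset `g` in `A?` allows the
    -- left margin to be expressed without subtraction.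
    B? : ∀ v → Dec (O v × (col v + j) / W ≤ i × i < suc ((g + g + col v + j) / W))
    B? v = O? v ×-dec (col v + j) / W ≤? i ×-dec i <? suc ((g + g + col v + j) / W)

    -- The sweep runs with `r + p` for `r`, so that a factor `suc r` is left after cancelling the
    -- `p * # A?` on its right-hand side.
    slab : suc r * # A? ≤ (suc r + (p + p)) * # B?
    slab = +-cancelʳ-≤ (p * # A?) _ _ (begin
      suc r * # A? + p * # A?                          ≡⟨ *-distribʳ-+ (# A?) (suc r) p ⟨
      suc (r + p) * # A?                               ≤⟨ sweep _ A? B? (λ _ → proj₁) (λ _ → proj₁) closed thin ≤-refl ⟩
      suc (r + p) * # B? + p * (# A? + # B?)           ≡⟨ e r p (# A?) (# B?) ⟩
      (suc r + (p + p)) * # B? + p * # A?              ∎)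
      where
      open ≤-Reasoning
      e : ∀ r p a b → suc (r + p) * b + p * (a + b) ≡ (suc r + (p + p)) * b + p * a
      e = solve-∀
      e₁ : ∀ x c j → x + c + c + j ≡ x + ((c + c) + j)
      e₁ = solve-∀
      e₂ : ∀ x c j → x + c + c + ((c + c) + j) ≡ (c + c) + (c + c) + x + j
      e₂ = solve-∀
      e₃ : ∀ x g j → g + g + x + j ≡ x + (g + g + j)
      e₃ = solve-∀
      e₄ : ∀ x g j → x + (g + g + j) ≡ x + j + (g + g)
      e₄ = solve-∀
      closed : ∀ v → L (l v) × (col (l v) + (g + j)) / W ≡ i →
               O (o v) × (col (o v) + j) / W ≤ i × i < suc ((g + g + col (o v) + j) / W)
      closed v (_ , refl) = o∈O v , /-monoˡ-≤ W (begin
        col (o v) + j              ≤⟨ +-monoˡ-≤ j (proj₂ (proj₂ (near-o v))) ⟩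
        col v + c + j              ≤⟨ +-monoˡ-≤ j (+-monoˡ-≤ c (proj₁ (proj₂ (near-l v)))) ⟩
        col (l v) + c + c + j      ≡⟨ e₁ (col (l v)) c j ⟩
        col (l v) + (g + j)        ∎) , s≤s (/-monoˡ-≤ W (begin
        col (l v) + (g + j)            ≤⟨ +-monoˡ-≤ (g + j) (proj₂ (proj₂ (near-l v))) ⟩
        col v + c + (g + j)            ≤⟨ +-monoˡ-≤ (g + j) (+-monoˡ-≤ c (proj₁ (proj₂ (near-o v)))) ⟩
        col (o v) + c + c + (g + j)    ≡⟨ e₂ (col (o v)) c j ⟩
        g + g + col (o v) + j          ∎))
      thin : Cut.Thin A? B?
      thin h = ≤-trans (+-mono-≤
        (BL.blob-sparse A? (λ v → l-fixed v ∘ proj₁) (g + j) (i * W) W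
          (λ { v (_ , refl) → m/n*n≤m (col v + (g + j)) W , m<[m/W]*W+W W (col v + (g + j)) }) h)
        (BO.blob-sparse B? (λ v → o-fixed v ∘ proj₁) (g + g + j) (i * W) (W + (g + g)) windowᴼ h)) p-large
        where
        windowᴼ : ∀ v → O v × (col v + j) / W ≤ i × i < suc ((g + g + col v + j) / W) →
          i * W ≤ col v + (g + g + j) × col v + (g + g + j) < i * W + (W + (g + g))
        windowᴼ v (_ , q , s≤s q′) = (begin
          i * W                                  ≤⟨ *-monoˡ-≤ W q′ ⟩
          (g + g + col v + j) / W * W            ≤⟨ m/n*n≤m (g + g + col v + j) W ⟩
          g + g + col v + j                      ≡⟨ e₃ (col v) g j ⟩
          col v + (g + g + j)                    ∎) , (begin-strict
          col v + (g + g + j)                    ≡⟨ e₄ (col v) g j ⟩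
          col v + j + (g + g)                    <⟨ +-monoˡ-< (g + g) (m<[m/W]*W+W W (col v + j)) ⟩
          (col v + j) / W * W + W + (g + g)      ≤⟨ +-monoˡ-≤ (g + g) (+-monoˡ-≤ W (*-monoˡ-≤ W q)) ⟩
          i * W + W + (g + g)                    ≡⟨ +-assoc (i * W) W (g + g) ⟩
          i * W + (W + (g + g))                  ∎)

  #slabs : ℕ
  #slabs = suc (sum col + (g + W))

  slab-index : ∀ (j : Fin W) v → (col v + (g + toℕ j)) / W < #slabs
  slab-index j v = s≤s (≤-trans (m/n≤m (col v + (g + toℕ j)) W)
    (+-mono-≤ (term≤sum col v) (+-monoʳ-≤ g (<⇒≤ (toℕ<n j)))))

  lower : W * # L? ≤ sum {W} (λ j → sum {#slabs} (λ i → # (A? (toℕ j) (toℕ i))))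
  lower = begin
    W * # L?                                  ≡⟨ sum-const W (# L?) ⟨
    sum {W} (λ j → # L?)                      ≤⟨ sum-mono (λ j → sum-mono (located j)) ⟩
    sum {W} (λ j → sum (λ v → sum {#slabs} (λ i → ι (A? (toℕ j) (toℕ i) v))))
      ≡⟨ sum-cong-≗ {W} (λ j → ∑-comm {n} {#slabs} (λ v i → ι (A? (toℕ j) (toℕ i) v))) ⟩
    sum {W} (λ j → sum {#slabs} (λ i → # (A? (toℕ j) (toℕ i)))) ∎
    where
    open ≤-Reasoning
    located : ∀ j v → ι (L? v) ≤ sum {#slabs} (λ i → ι (A? (toℕ j) (toℕ i) v))
    located j v = ≤-trans
      (ι-mono (L? v) (A? (toℕ j) (toℕ k) v) (λ q → q , sym (toℕ-fromℕ< (slab-index j v))))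
      (term≤sum (λ i → ι (A? (toℕ j) (toℕ i) v)) k)
      where k = fromℕ< (slab-index j v)

  -- For a member `v` of O, shift `j` contributes at most one plus the difference of the floors for
  -- `g + g + col v + j` and `col v + j`. Over all `j` the floors differ by `g + g` in total, by
  -- `floors-+`.
  upper : sum {W} (λ j → sum {#slabs} (λ i → # (B? (toℕ j) (toℕ i)))) ≤ (W + (g + g)) * # O?
  upper = begin
    sum {W} (λ j → sum {#slabs} (λ i → # (B? (toℕ j) (toℕ i))))
      ≡⟨ swap₃ {W} {#slabs} (λ j i v → ι (B? (toℕ j) (toℕ i) v)) ⟩
    sum (λ v → sum {W} (λ j → sum {#slabs} (λ i → ι (B? (toℕ j) (toℕ i) v))))  ≤⟨ sum-mono each ⟩
    sum (λ v → (W + (g + g)) * ι (O? v))      ≡⟨ *-distribˡ-sum (W + (g + g)) (λ v → ι (O? v)) ⟨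
    (W + (g + g)) * # O?                      ∎
    where
    open ≤-Reasoning
    α β : Fin n → ℕ → ℕ
    α v j = (col v + j) / W
    β v j = suc ((g + g + col v + j) / W)
    in? : ∀ v j i → Dec (α v j ≤ i × i < β v j)
    in? v j i = α v j ≤? i ×-dec i <? β v j
    total : ∀ v → sum {W} (λ j → sum {#slabs} (λ i → ι (in? v (toℕ j) (toℕ i)))) ≤ W + (g + g)
    total v = +-cancelʳ-≤ (floors W (col v)) _ _ (begin
      sum {W} (λ j → sum {#slabs} (λ i → ι (in? v (toℕ j) (toℕ i)))) + floors W (col v)
        ≡⟨ ∑-distrib-+ {W} (λ j → sum {#slabs} (λ i → ι (in? v (toℕ j) (toℕ i)))) (λ j → α v (toℕ j)) ⟨
      sum {W} (λ j → sum {#slabs} (λ i → ι (in? v (toℕ j) (toℕ i))) + α v (toℕ j))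
        ≤⟨ sum-mono {W} (λ j → interval-count #slabs (α v (toℕ j)) (β v (toℕ j))
             (m≤n⇒m≤1+n (/-monoˡ-≤ W (+-monoˡ-≤ (toℕ j) (m≤n+m (col v) (g + g)))))) ⟩
      sum {W} (λ j → 1 + (g + g + col v + toℕ j) / W)
        ≡⟨ ∑-distrib-+ {W} (λ _ → 1) (λ j → (g + g + col v + toℕ j) / W) ⟩
      sum {W} (λ _ → 1) + floors W (g + g + col v)
        ≡⟨ cong₂ _+_ (trans (sum-const W 1) (*-identityʳ W)) (floors-+ W (g + g) (col v)) ⟩
      W + (g + g + floors W (col v))
        ≡⟨ +-assoc W (g + g) _ ⟨
      W + (g + g) + floors W (col v)   ∎)
    each : ∀ v → sum {W} (λ j → sum {#slabs} (λ i → ι (B? (toℕ j) (toℕ i) v))) ≤ (W + (g + g)) * ι (O? v)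
    each v with O? v
    ... | yes q = ≤-trans (total v) (≤-reflexive (sym (*-identityʳ _)))
    ... | no _  = ≤-reflexive (trans (sum-zero {W} λ j → sum-zero {#slabs} λ i → refl) (sym (*-zeroʳ (W + (g + g)))))

  comparison : suc r * (W * # L?) ≤ (suc r + (p + p)) * ((W + (g + g)) * # O?)
  comparison = begin
    suc r * (W * # L?)    ≤⟨ *-monoʳ-≤ (suc r) lower ⟩
    suc r * sum {W} (λ j → sum {#slabs} (λ i → # (A? (toℕ j) (toℕ i))))
      ≡⟨ scale (suc r) (λ j i → # (A? (toℕ j) (toℕ i))) ⟩
    sum {W} (λ j → sum {#slabs} (λ i → suc r * # (A? (toℕ j) (toℕ i))))
      ≤⟨ sum-mono {W} (λ j → sum-mono {#slabs} (λ i → slab (toℕ j) (toℕ i))) ⟩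
    sum {W} (λ j → sum {#slabs} (λ i → (suc r + (p + p)) * # (B? (toℕ j) (toℕ i))))
      ≡⟨ scale (suc r + (p + p)) (λ j i → # (B? (toℕ j) (toℕ i))) ⟨
    (suc r + (p + p)) * sum {W} (λ j → sum {#slabs} (λ i → # (B? (toℕ j) (toℕ i))))
      ≤⟨ *-monoʳ-≤ (suc r + (p + p)) upper ⟩
    (suc r + (p + p)) * ((W + (g + g)) * # O?)  ∎
    where
    open ≤-Reasoning
    scale : ∀ k (f : Fin W → Fin #slabs → ℕ) → k * sum (λ j → sum (f j)) ≡ sum (λ j → sum (λ i → k * f j i))
    scale k f = trans (*-distribˡ-sum k (λ j → sum (f j))) (sum-cong-≗ {W} λ j → *-distribˡ-sum k (f j))

-- Paths on the grid

offset : Fin 4 → Point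
offset 0F = 1ℤ , 0ℤ
offset 1F = ℤ.-1ℤ , 0ℤ
offset 2F = 0ℤ , 1ℤ
offset 3F = 0ℤ , ℤ.-1ℤ

-- The offset is subtracted because it then equals the difference of coordinates taken in
-- `GridEdge`.
neighbour : Fin 4 → Point → Point
neighbour e (x , y) = x - proj₁ (offset e) , y - proj₂ (offset e)

i-[i-j]≡j : ∀ i j → i - (i - j) ≡ j
i-[i-j]≡j = ℤ.solve-∀

gridEdge-neighbour : ∀ e p → GridEdge p (neighbour e p)
gridEdge-neighbour e (x , y) = trans
  (cong₂ (λ i j → ℤ.∣ i ∣ + ℤ.∣ j ∣) (i-[i-j]≡j x (proj₁ (offset e))) (i-[i-j]≡j y (proj₂ (offset e)))) (unit e)
  where
  unit : ∀ e → ℤ.∣ proj₁ (offset e) ∣ + ℤ.∣ proj₂ (offset e) ∣ ≡ 1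
  unit 0F = refl
  unit 1F = refl
  unit 2F = refl
  unit 3F = refl

neighbour-gridEdge : ∀ p q → GridEdge p q → ∃[ e ] neighbour e p ≡ q
neighbour-gridEdge (x , y) (x′ , y′) edge =
  let e , p , q = direction (x - x′) (y - y′) edge in
  e , cong₂ _,_ (trans (cong (x -_) p) (i-[i-j]≡j x x′)) (trans (cong (y -_) q) (i-[i-j]≡j y y′))
  where
  direction : ∀ i j → ℤ.∣ i ∣ + ℤ.∣ j ∣ ≡ 1 → ∃[ e ] proj₁ (offset e) ≡ i × proj₂ (offset e) ≡ j
  direction (pos 1)    (pos 0)    refl = 0F , refl , refl
  direction -[1+ 0 ] (pos 0)    refl = 1F , refl , refl
  direction (pos 0)    (pos 1)    refl = 2F , refl , refl
  direction (pos 0)    -[1+ 0 ] refl = 3F , refl , refl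
  direction (pos (suc m)) (pos (suc k)) e with +-suc m k
  ... | s = ⊥-elim (0≢1+n (sym (trans (sym s) (suc-injective e))))
  direction (pos (suc m)) -[1+ k ] e with +-suc m k
  ... | s = ⊥-elim (0≢1+n (sym (trans (sym s) (suc-injective e))))
  direction -[1+ m ] (pos (suc k)) e with +-suc m k
  ... | s = ⊥-elim (0≢1+n (sym (trans (sym s) (suc-injective e))))
  direction -[1+ m ] -[1+ k ] e with +-suc m k
  ... | s = ⊥-elim (0≢1+n (sym (trans (sym s) (suc-injective e))))

gridEdge-sym : ∀ p q → GridEdge p q → GridEdge q p
gridEdge-sym (x , y) (x′ , y′) e = trans (cong₂ _+_ (ℤ.∣i-j∣≡∣j-i∣ x′ x) (ℤ.∣i-j∣≡∣j-i∣ y′ y)) e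

row-suc : ∀ p q → GridEdge p q → proj₂ q ℤ.≤ ℤ.suc (proj₂ p)
row-suc p@(x , y) q edge with neighbour-gridEdge p q edge
... | e , refl = ℤ.≤-trans (ℤ.+-monoʳ-≤ y (small e)) (ℤ.≤-reflexive (ℤ.+-comm y 1ℤ))
  where
  small : ∀ e → ℤ.- proj₂ (offset e) ℤ.≤ 1ℤ
  small 0F = +≤+ z≤n
  small 1F = +≤+ z≤n
  small 2F = -≤+
  small 3F = +≤+ (s≤s z≤n)

-- A discrete intermediate value theorem: a grid-edge climbs at most one row, so no row is skipped.
ascend : ∀ {p ps q y} → Linked GridEdge (p ∷ ps) → q ∈ˡ p ∷ ps → proj₂ p ℤ.≤ y → y ℤ.≤ proj₂ q →
         ∃[ x ] (x , y) ∈ˡ p ∷ ps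
ascend {p} {y = y} _ (here refl) below above =
  proj₁ p , here (cong (proj₁ p ,_) (ℤ.≤-antisym above below))
ascend {p} {p′ ∷ ps} {y = y} (edge ∷ link) (there q∈) below above with proj₂ p ℤ.≟ y
... | yes eq = proj₁ p , here (cong (proj₁ p ,_) (sym eq))
... | no neq = let x , x∈ = ascend link q∈
                     (ℤ.≤-trans (row-suc p p′ edge) (ℤ.i<j⇒suc[i]≤j (ℤ.≤∧≢⇒< below neq))) above
               in x , there x∈

descend : ∀ {p ps q y} → Linked GridEdge (p ∷ ps) → q ∈ˡ p ∷ ps → y ℤ.≤ proj₂ p → proj₂ q ℤ.≤ y →
          ∃[ x ] (x , y) ∈ˡ p ∷ ps
descend {p} _ (here refl) below above = proj₁ p , here (cong (proj₁ p ,_) (ℤ.≤-antisym below above))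
descend {p} {p′ ∷ ps} {y = y} (edge ∷ link) (there q∈) below above with y ℤ.≟ proj₂ p
... | yes eq = proj₁ p , here (cong (proj₁ p ,_) eq)
... | no neq = let x , x∈ = descend link q∈ (suc-cancel-≤ (ℤ.≤-trans (ℤ.i<j⇒suc[i]≤j (ℤ.≤∧≢⇒< below neq))
                     (row-suc p′ p (gridEdge-sym p p′ edge)))) above
               in x , there x∈
  where
  suc-cancel-≤ : ∀ {i j} → ℤ.suc i ℤ.≤ ℤ.suc j → i ℤ.≤ j
  suc-cancel-≤ {i} {j} le = subst₂ ℤ._≤_ (ℤ.pred-suc i) (ℤ.pred-suc j) (ℤ.+-monoʳ-≤ ℤ.-1ℤ le)

-- A path has at least one grid-edge, so even its last point lies on one. This turns the bound on
-- the load of edges into a bound at points.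
incident : ∀ {r} p q ps → Linked GridEdge (p ∷ q ∷ ps) → r ∈ˡ p ∷ q ∷ ps →
  ∃[ s ] GridEdge r s × ((r , s) ∈ˡ zip (p ∷ q ∷ ps) (q ∷ ps) ⊎ (s , r) ∈ˡ zip (p ∷ q ∷ ps) (q ∷ ps))
incident p q ps        (edge ∷ _)    (here refl)         = q , edge , inj₁ (here refl)
incident p q []        (edge ∷ _)    (there (here refl)) = p , gridEdge-sym p q edge , inj₂ (here refl)
incident p q (q′ ∷ ps) (edge ∷ link) (there r∈)          =
  let s , e , u = incident q q′ ps link r∈ in s , e , Sum.map there there u

module _ (P : Path) where
  open Path P

  bottommost topmost : Point
  bottommost = ℤᴱ.argmin proj₂ start points
  topmost    = ℤᴱ.argmax proj₂ start points

  ymin ymax : ℤ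
  ymin = proj₂ bottommost
  ymax = proj₂ topmost

  bottommost∈ : bottommost ∈ˡ points
  bottommost∈ = [ here , id ]′ (ℤᴱ.argmin-sel proj₂ start points)

  topmost∈ : topmost ∈ˡ points
  topmost∈ = [ here , id ]′ (ℤᴱ.argmax-sel proj₂ start points)

  visits-row : ∀ {y} → ymin ℤ.≤ y → y ℤ.≤ ymax → ∃[ x ] (x , y) ∈ˡ points
  visits-row {y} p q with ℤ.≤-total (proj₂ start) y
  ... | inj₁ le = ascend linked topmost∈ le q
  ... | inj₂ ge = descend linked bottommost∈ ge p

  ymin≤ : ∀ {p} → p ∈ˡ points → ymin ℤ.≤ proj₂ p
  ymin≤ = All.lookup (ℤᴱ.f[argmin]≤f[xs] {f = proj₂} start points)

  ≤ymax : ∀ {p} → p ∈ˡ points → proj₂ p ℤ.≤ ymax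
  ≤ymax = All.lookup (ℤᴱ.f[xs]≤f[argmax] {f = proj₂} start points)

  xmin≤ : ∀ {p} → p ∈ˡ points → xmin ℤ.≤ proj₁ p
  xmin≤ p∈ = All.lookup (ℤᴱ.min≤xs (proj₁ start) (map proj₁ points)) (∈-map⁺ proj₁ p∈)

  ≤xmax : ∀ {p} → p ∈ˡ points → proj₁ p ℤ.≤ xmax
  ≤xmax p∈ = All.lookup (ℤᴱ.xs≤max (proj₁ start) (map proj₁ points)) (∈-map⁺ proj₁ p∈)

  uses-neighbour : ∀ {p} → p ∈ˡ points → ∃[ e ] Uses p (neighbour e p)
  uses-neighbour {p} p∈ with incident start next rest linked p∈
  ... | s , edge , used with neighbour-gridEdge p s edge
  ...   | e , refl = e , used

#-allFin : ∀ {n} {A : Fin n → Set} (A? : ∀ v → Dec (A v)) → # A? ≡ length (filter A? (allFin n))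
#-allFin A? = go A? id
  where
  go : ∀ {m n} {A : Fin n → Set} (A? : ∀ v → Dec (A v)) (f : Fin m → Fin n) →
       # (A? ∘ f) ≡ length (filter A? (tabulate f))
  go {zero}  A? f = refl
  go {suc m} A? f with does (A? (f Fin.zero))
  ... | true  = cong suc (go A? (f ∘ Fin.suc))
  ... | false = go A? (f ∘ Fin.suc)

ι-true : ∀ {P : Set} (p? : Dec P) → P → 1 ≤ ι p?
ι-true (yes _) _ = s≤s z≤n
ι-true (no ¬p) p = ⊥-elim (¬p p)

ι-bound : ∀ {P : Set} (p? : Dec P) {m} → (P → 1 ≤ m) → ι p? ≤ m
ι-bound (yes p) f = f p
ι-bound (no _)  f = z≤n

-- Only meaningful if z + k is nonnegative.
shift : ℕ → ℤ → ℕ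
shift k z = ℤ.∣ z ℤ.+ pos k ∣

offset-nonneg : ∀ z {k} → ℤ.∣ z ∣ ≤ k → 0ℤ ℤ.≤ z ℤ.+ pos k
offset-nonneg (pos m)    _ = +≤+ z≤n
offset-nonneg -[1+ m ] p rewrite ℤ.⊖-≥ p = +≤+ z≤n

i+k-k≡i : ∀ i k → i ℤ.+ k - k ≡ i
i+k-k≡i = ℤ.solve-∀

module _ {k : ℕ} {z : ℤ} (nonneg : 0ℤ ℤ.≤ z ℤ.+ pos k) where

  +shift : pos (shift k z) ≡ z ℤ.+ pos k
  +shift = ℤ.0≤i⇒+∣i∣≡i nonneg

  +shift-k : pos (shift k z) - pos k ≡ z
  +shift-k = trans (cong (_- pos k) +shift) (i+k-k≡i z (pos k))

  shift≤⇒ : ∀ {m} → shift k z ≤ m → z ℤ.≤ pos m - pos k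
  shift≤⇒ p = subst (ℤ._≤ _) +shift-k (ℤ.+-monoˡ-≤ (ℤ.- pos k) (+≤+ p))

  ≤shift⇒ : ∀ {m} → m ≤ shift k z → pos m - pos k ℤ.≤ z
  ≤shift⇒ p = subst (_ ℤ.≤_) +shift-k (ℤ.+-monoˡ-≤ (ℤ.- pos k) (+≤+ p))

  shift-mono : ∀ {z′} → z ℤ.≤ z′ → shift k z ≤ shift k z′
  shift-mono {z′} p = ℤ.drop‿+≤+ (subst₂ ℤ._≤_ (sym +shift) (sym (ℤ.0≤i⇒+∣i∣≡i (ℤ.≤-trans nonneg q))) q)
    where
    q : z ℤ.+ pos k ℤ.≤ z′ ℤ.+ pos k
    q = ℤ.+-monoˡ-≤ (pos k) p

  shift-+ : ∀ c → shift k (z ℤ.+ pos c) ≡ shift k z + c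
  shift-+ c = ℤ.+-injective (trans (ℤ.0≤i⇒+∣i∣≡i (ℤ.≤-trans nonneg (ℤ.+-monoˡ-≤ (pos k) (ℤ.i≤i+j z (pos c)))))
    (trans (e z (pos c) (pos k)) (cong (ℤ._+ pos c) (sym +shift))))
    where
    e : ∀ z c k → z ℤ.+ c ℤ.+ k ≡ z ℤ.+ k ℤ.+ c
    e = ℤ.solve-∀

-- Through v e p means that the path of v uses the grid-edge leaving p in
-- direction e.
record Drawing (n c t : ℕ) : Set₁ where
  field
    leftmost bottom top : Fin n → ℤ
    Visits              : Fin n → Point → Set
    Through             : Fin n → Fin 4 → Point → Set
    through?            : ∀ v e p → Dec (Through v e p)
    through             : ∀ {v p} → Visits v p → ∃[ e ] Through v e p
    load≤t              : ∀ e p → # (λ v → through? v e p) ≤ t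
    bottom≤top          : ∀ v → bottom v ℤ.≤ top v
    bottom≤             : ∀ {v p} → Visits v p → bottom v ℤ.≤ proj₂ p
    ≤top                : ∀ {v p} → Visits v p → proj₂ p ℤ.≤ top v
    leftmost≤           : ∀ {v p} → Visits v p → leftmost v ℤ.≤ proj₁ p
    ≤leftmost+c         : ∀ {v p} → Visits v p → proj₁ p ℤ.≤ leftmost v ℤ.+ pos c
    row                 : ∀ {v y} → bottom v ℤ.≤ y → y ℤ.≤ top v → ∃[ x ] Visits v (x , y)

-- From drawings to layouts

module DrawingLayout {n c t : ℕ} (𝒟 : Drawing n c t) where
  open Drawing 𝒟

  -- Sums serve as common bounds on the absolute values, to translate the drawing to natural
  -- coordinates.
  X Y : ℕ
  X = sum λ v → ℤ.∣ leftmost v ∣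
  Y = sum λ v → ℤ.∣ bottom v ∣

  leftmost-ok : ∀ v → 0ℤ ℤ.≤ leftmost v ℤ.+ pos X
  leftmost-ok v = offset-nonneg (leftmost v) (term≤sum (λ v → ℤ.∣ leftmost v ∣) v)

  bottom-ok : ∀ v → 0ℤ ℤ.≤ bottom v ℤ.+ pos Y
  bottom-ok v = offset-nonneg (bottom v) (term≤sum (λ v → ℤ.∣ bottom v ∣) v)

  later : ∀ {a b k} → a ℤ.≤ b → 0ℤ ℤ.≤ a ℤ.+ pos k → 0ℤ ℤ.≤ b ℤ.+ pos k
  later {k = k} p q = ℤ.≤-trans q (ℤ.+-monoˡ-≤ (pos k) p)

  col lo hi : Fin n → ℕ
  col v = shift X (leftmost v)
  lo v  = shift Y (bottom v)
  hi v  = shift Y (top v)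

  col≤ : ∀ {v p} → Visits v p → col v ≤ shift X (proj₁ p)
  col≤ {v} q = shift-mono {X} {leftmost v} (leftmost-ok v) (leftmost≤ q)

  ≤col+c : ∀ {v p} → Visits v p → shift X (proj₁ p) ≤ col v + c
  ≤col+c {v} {x , _} q = ≤-trans (shift-mono {X} {x} (later (leftmost≤ q) (leftmost-ok v)) (≤leftmost+c q))
    (≤-reflexive (shift-+ {X} {leftmost v} (leftmost-ok v) c))

  module _ (h a w : ℕ) where

    cell : Fin (w + c) → Point
    cell k = pos (a + toℕ k) - pos X , pos h - pos Y

    slot : Fin (w + c) → Fin 4 → Fin n → ℕ
    slot k e v = ι (through? v e (cell k))

    occupied : ∀ v → (lo v ≤ h × h ≤ hi v) × (a ≤ col v × col v < a + w) →
               1 ≤ sum (λ k → sum (λ e → slot k e v))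
    occupied v ((p , q) , (r , s)) = begin
      1                                    ≤⟨ ι-true (through? v e (cell k)) (proj₂ used) ⟩
      slot k e v                           ≤⟨ term≤sum (λ e → slot k e v) e ⟩
      sum (λ e → slot k e v)               ≤⟨ term≤sum (λ k → sum (λ e → slot k e v)) k ⟩
      sum (λ k → sum (λ e → slot k e v))   ∎
      where
      open ≤-Reasoning
      visited : ∃[ x ] Visits v (x , pos h - pos Y)
      visited = row (shift≤⇒ {Y} {bottom v} (bottom-ok v) p)
        (≤shift⇒ {Y} {top v} (later (bottom≤top v) (bottom-ok v)) q)
      x : ℤ
      x = proj₁ visited
      a+[x-a]≡x : a + (shift X x ∸ a) ≡ shift X x
      a+[x-a]≡x = m+[n∸m]≡n (≤-trans r (col≤ (proj₂ visited)))
      k<w+c : shift X x ∸ a < w + c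
      k<w+c = +-cancelˡ-< a _ _ (begin-strict
        a + (shift X x ∸ a)    ≡⟨ a+[x-a]≡x ⟩
        shift X x              ≤⟨ ≤col+c (proj₂ visited) ⟩
        col v + c              <⟨ +-monoˡ-< c s ⟩
        a + w + c              ≡⟨ +-assoc a w c ⟩
        a + (w + c)            ∎)
      k : Fin (w + c)
      k = fromℕ< k<w+c
      x≡cell : x ≡ proj₁ (cell k)
      x≡cell = sym (trans
        (cong (λ m → pos m - pos X) (trans (cong (a +_) (toℕ-fromℕ< k<w+c)) a+[x-a]≡x))
        (+shift-k {X} {x} (later (leftmost≤ (proj₂ visited)) (leftmost-ok v))))
      used : ∃[ e ] Through v e (cell k)
      used = through (subst (λ x → Visits v (x , pos h - pos Y)) x≡cell (proj₂ visited))
      e : Fin 4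
      e = proj₁ used

    -- Double counting of cells, directions and paths: each counted path leaves one of the `w + c`
    -- cells in one of four directions, and each of these edges has load at most `t`.
    crowd : # (λ v → (lo v ≤? h ×-dec h ≤? hi v) ×-dec (a ≤? col v ×-dec col v <? a + w)) ≤ (w + c) * (4 * t)
    crowd = begin
      # (λ v → (lo v ≤? h ×-dec h ≤? hi v) ×-dec (a ≤? col v ×-dec col v <? a + w))
        ≤⟨ sum-mono (λ v → ι-bound ((lo v ≤? h ×-dec h ≤? hi v) ×-dec (a ≤? col v ×-dec col v <? a + w)) (occupied v)) ⟩
      sum (λ v → sum (λ k → sum (λ e → slot k e v)))       ≡⟨ swap₃ slot ⟨
      sum (λ k → sum (λ e → sum (slot k e)))
        ≤⟨ sum-mono {w + c} (λ k → sum-mono {4} (λ e → load≤t e (cell k))) ⟩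
      sum {w + c} (λ k → sum {4} (λ e → t))
        ≡⟨ trans (sum-const (w + c) (sum {4} (λ e → t))) (cong ((w + c) *_) (sum-const 4 t)) ⟩
      (w + c) * (4 * t)                                    ∎
      where open ≤-Reasoning

  layout : Layout n c (4 * t)
  layout = record
    { col    = col
    ; lo     = lo
    ; hi     = hi
    ; lo≤hi  = λ v → shift-mono {Y} {bottom v} (bottom-ok v) (bottom≤top v)
    ; sparse = crowd
    }

  open Layout layout using (Near; lo≤hi)

  near-refl : ∀ v → Near v v
  near-refl v = (lo≤hi v , lo≤hi v) , (m≤m+n (col v) c , m≤m+n (col v) c)

  near-visits : ∀ {u v p} → Visits u p → Visits v p → Near u v
  near-visits {p = p} q r = (rows q r , rows r q) , (columns q r , columns r q)
    where
    rows : ∀ {u v} → Visits u p → Visits v p → lo u ≤ hi v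
    rows {u} {v} q r = shift-mono {Y} {bottom u} (bottom-ok u) (ℤ.≤-trans (bottom≤ q) (≤top r))
    columns : ∀ {u v} → Visits u p → Visits v p → col u ≤ col v + c
    columns q r = ≤-trans (col≤ q) (≤col+c r)

module _ {b : Polynomial} {t c : ℕ} {I : Instance} (restricted : Restricted b t c I) where
  open Instance I
  open Restricted restricted
  open Path using (points; xmin; xmax; uses?; Uses)

  drawing : Drawing n c t
  drawing = record
    { leftmost    = λ v → xmin (path v)
    ; bottom      = λ v → ymin (path v)
    ; top         = λ v → ymax (path v)
    ; Visits      = λ v p → p ∈ˡ points (path v)
    ; Through     = λ v e p → Uses (path v) p (neighbour e p)
    ; through?    = λ v e p → uses? (path v) p (neighbour e p)
    ; through     = λ {v} → uses-neighbour (path v)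
    ; load≤t      = λ e p → ≤-trans (≤-reflexive (#-allFin (λ v → uses? (path v) p (neighbour e p))))
                      (fewPaths p (neighbour e p) (gridEdge-neighbour e p))
    ; bottom≤top  = λ v → ymin≤ (path v) (topmost∈ (path v))
    ; bottom≤     = λ {v} → ymin≤ (path v)
    ; ≤top        = λ {v} → ≤ymax (path v)
    ; leftmost≤   = λ {v} → xmin≤ (path v)
    ; ≤leftmost+c = λ {v} p∈ → ℤ.≤-trans (≤xmax (path v) p∈) (width v)
    ; row         = λ {v} → visits-row (path v)
    }
    where
    cancel : ∀ i j → i - j ℤ.+ j ≡ i
    cancel = ℤ.solve-∀
    width : ∀ v → xmax (path v) ℤ.≤ xmin (path v) ℤ.+ pos c
    width v = subst₂ ℤ._≤_ (cancel (xmax (path v)) (xmin (path v))) (ℤ.+-comm (pos c) (xmin (path v)))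
      (ℤ.+-monoˡ-≤ (xmin (path v)) (narrow v))

  adjacent-visits : ∀ {u v} → Adjacent graph u v → ∃[ p ] Drawing.Visits drawing u p × Drawing.Visits drawing v p
  adjacent-visits {u} {v} uv = Equivalence.to (adjacent u v λ { refl → subst T (Graph.irreflexive graph u) uv }) uv

-- The exchange argument

does⁺ : {P : Set} (p? : Dec P) → P → T (does p?)
does⁺ (yes _) _ = tt
does⁺ (no ¬p) p = ¬p p

does⁻ : {P : Set} (p? : Dec P) → T (does p?) → P
does⁻ (yes p) _ = p

-- The losses along rows and across slabs are each a factor `1 + 1/e`. As `e = 4 (m + 1)`, their
-- product is at most `1 + 3/e`, below `1 + 1/(m + 1)`.
ratio-arithmetic : ∀ m P G x y .{{_ : NonZero P}} .{{_ : NonZero G}} → let e = 4 * suc m in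
  P * e * (G * e * x) ≤ (P * e + P) * ((G * e + G) * y) → suc m * x ≤ suc (suc m) * y
ratio-arithmetic m P G x y le = *-cancelˡ-≤ (16 * suc m) (begin
  16 * suc m * (suc m * x)                    ≡⟨ e₁ (suc m) x ⟩
  4 * suc m * (4 * suc m) * x                 ≤⟨ *-cancelˡ-≤ (P * G) {{m*n≢0 P G}} 
    (subst₂ _≤_ (e₂ P G (4 * suc m) x) (e₃ P G (4 * suc m) y) le) ⟩
  (4 * suc m + 1) * (4 * suc m + 1) * y       ≤⟨ *-monoˡ-≤ y
    (≤-trans (m≤m+n ((4 * suc m + 1) * (4 * suc m + 1)) (8 * m + 7)) (≤-reflexive (e₄ m))) ⟩
  16 * suc m * suc (suc m) * y                ≡⟨ *-assoc (16 * suc m) (suc (suc m)) y ⟩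
  16 * suc m * (suc (suc m) * y)              ∎)
  where
  open ≤-Reasoning
  e₁ : ∀ m x → 16 * m * (m * x) ≡ 4 * m * (4 * m) * x
  e₁ = solve-∀
  e₂ : ∀ P G e x → P * e * (G * e * x) ≡ P * G * (e * e * x)
  e₂ = solve-∀
  e₃ : ∀ P G e y → (P * e + P) * ((G * e + G) * y) ≡ P * G * ((e + 1) * (e + 1) * y)
  e₃ = solve-∀
  e₄ : ∀ m → (4 * suc m + 1) * (4 * suc m + 1) + (8 * m + 7) ≡ 16 * suc m * suc (suc m)
  e₄ = solve-∀

-- For the ratio 1 + 1 / (m + 1): the width W of the slabs, a bound p on
-- the number of intervals of a slab that meet a row, the guaranteed
-- progress r of each cut (minus 1), and the size K of an exchange.  Here
-- (W + 4c) / W = (r + 2p) / r = 1 + 1 / (4m + 4).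
slabWidth crossing spacing radius : ℕ → ℕ → ℕ → ℕ
slabWidth m c t = ((c + c) + (c + c)) * (4 * suc m)
crossing m c t  = suc ((W + (c + c) + c) * (4 * t) + (W + ((c + c) + (c + c)) + (c + c) + c) * (4 * t))
  where W = slabWidth m c t
spacing m c t   = pred ((p + p) * (4 * suc m))
  where p = crossing m c t
radius m c t    = suc (spacing m c t + p) + (p + p)
  where p = crossing m c t

module Ratio {n c t : ℕ} (m : ℕ) .{{_ : NonZero c}} (𝒟 : Drawing n c t) (adj : Fin n → Fin n → Bool)
  (meet : ∀ {u v} → T (adj u v) → ∃[ p ] Drawing.Visits 𝒟 u p × Drawing.Visits 𝒟 v p)
  (χ ω : Fin n → Bool) (χ-dominating : ∀ v → Covered adj χ v) (ω-dominating : ∀ v → Covered adj ω v)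
  (locally-optimal : ∀ χ′ → (∀ v → Covered adj χ′ v) → # (λ v → T? (χ v xor χ′ v)) ≤ radius m c t →
    # (λ v → T? (χ v)) ≤ # (λ v → T? (χ′ v)))
  where

  open DrawingLayout 𝒟 using (layout; near-refl; near-visits)
  open Layout layout using (Near)

  module Dominator (ψ : Fin n → Bool) (dominating : ∀ v → Covered adj ψ v) where

    -- Members of the set are sent to themselves, so that each of them is the centre of its own
    -- fibre.
    choice : ∀ v → ∃[ u ] T (ψ u) × (u ≡ v ⊎ T (adj v u)) × (T (ψ v) → u ≡ v)
    choice v with T? (ψ v) | dominating v
    ... | yes q | _                 = v , q , inj₁ refl , λ _ → refl
    ... | no ¬q | inj₁ q            = ⊥-elim (¬q q)
    ... | no ¬q | inj₂ (u , uv , q) = u , q , inj₂ uv , ⊥-elim ∘ ¬q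

    dominator : Fin n → Fin n
    dominator v = proj₁ (choice v)

    dominator∈ : ∀ v → T (ψ (dominator v))
    dominator∈ v = proj₁ (proj₂ (choice v))

    dominator-fixed : ∀ v → T (ψ v) → dominator v ≡ v
    dominator-fixed v = proj₂ (proj₂ (proj₂ (choice v)))

    covered : ∀ {χ′ : Fin n → Bool} v → T (χ′ (dominator v)) → Covered adj χ′ v
    covered {χ′} v q with proj₁ (proj₂ (proj₂ (choice v)))
    ... | inj₁ eq = inj₁ (subst (T ∘ χ′) eq q)
    ... | inj₂ uv = inj₂ (dominator v , uv , q)

    dominator-near : ∀ v → Near v (dominator v)
    dominator-near v with proj₁ (proj₂ (proj₂ (choice v)))
    ... | inj₁ eq = subst (Near v) (sym eq) (near-refl v)
    ... | inj₂ uv = let p , q , r = meet uv in near-visits {v} {dominator v} {p} q r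

  private
    module L = Dominator χ χ-dominating
    module O = Dominator ω ω-dominating

  module _ {A B : Fin n → Set} (A? : ∀ v → Dec (A v)) (B? : ∀ v → Dec (B v)) where

    swapped? : ∀ v → Dec ((T (χ v) × ¬ A v) ⊎ B v)
    swapped? v = (T? (χ v) ×-dec ¬? (A? v)) ⊎-dec B? v

    swapped : Fin n → Bool
    swapped v = does (swapped? v)

    swapped⁺ : ∀ {v} → (T (χ v) × ¬ A v) ⊎ B v → T (swapped v)
    swapped⁺ {v} = does⁺ (swapped? v)

    swapped⁻ : ∀ v → T (swapped v) → (T (χ v) × ¬ A v) ⊎ B v
    swapped⁻ v = does⁻ (swapped? v)

    exchange : (∀ v → A v → T (χ v)) → (∀ v → B v → T (ω v)) → (∀ v → A (L.dominator v) → B (O.dominator v)) →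
      # A? + # B? ≤ radius m c t → # A? ≤ # B?
    exchange A⊆χ _ closed small = +-cancelʳ-≤ (# kept?) _ _ (begin
      # A? + # kept?                ≤⟨ #-× A? kept? (λ v → T? (χ v)) never? A⊆χ (λ _ → proj₁) (λ v α (_ , ¬α) → ¬α α) ⟩
      # (λ v → T? (χ v)) + # never? ≡⟨ trans (cong (# (λ v → T? (χ v)) +_) (sum-zero {n} λ _ → refl)) (+-identityʳ _) ⟩
      # (λ v → T? (χ v))            ≤⟨ locally-optimal swapped dominating
        (≤-trans (#-⊎ (λ v → T? (χ v xor swapped v)) A? B? changed) small) ⟩
      # (λ v → T? (swapped v))      ≤⟨ #-⊎ (λ v → T? (swapped v)) kept? B? swapped⁻ ⟩
      # kept? + # B?                ≡⟨ +-comm (# kept?) (# B?) ⟩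
      # B? + # kept?                ∎)
      where
      open ≤-Reasoning
      kept? : ∀ v → Dec (T (χ v) × ¬ A v)
      kept? v = T? (χ v) ×-dec ¬? (A? v)
      never? : ∀ (v : Fin n) → Dec ⊥
      never? _ = no id
      dominating : ∀ v → Covered adj swapped v
      dominating v with A? (L.dominator v)
      ... | yes α = O.covered v (swapped⁺ (inj₂ (closed v α)))
      ... | no ¬α = L.covered v (swapped⁺ (inj₁ (L.dominator∈ v , ¬α)))
      changed : ∀ v → T (χ v xor swapped v) → A v ⊎ B v
      changed v = differ (χ v) (A? v) (B? v)
        where
        differ : ∀ {A B : Set} b (a? : Dec A) (b? : Dec B) → T (b xor does ((T? b ×-dec ¬? a?) ⊎-dec b?)) → A ⊎ B
        differ b     (yes α) _       _ = inj₁ α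
        differ b     (no _)  (yes β) _ = inj₂ β
        differ true  (no _)  (no _)  ()
        differ false (no _)  (no _)  ()

  private
    W p : ℕ
    W = slabWidth m c t
    p = crossing m c t

    instance
      nonZero-c+c : NonZero ((c + c) + (c + c))
      nonZero-c+c = >-nonZero (≤-trans (>-nonZero⁻¹ c) (≤-trans (m≤m+n c c) (m≤m+n (c + c) (c + c))))
      nonZero-W : NonZero W
      nonZero-W = m*n≢0 ((c + c) + (c + c)) (4 * suc m)

  -- `P = p + p` and `G = 4c` fit by computation: `W` is `G * e`, and the `suc` in `crossing` lets
  -- `suc (spacing m c t)` reduce to `P * e`.
  ratio : suc m * # (λ v → T? (χ v)) ≤ suc (suc m) * # (λ v → T? (ω v))
  ratio = ratio-arithmetic m (p + p) ((c + c) + (c + c)) (# (λ v → T? (χ v))) (# (λ v → T? (ω v)))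
    (Compare.comparison layout (T ∘ χ) (T ∘ ω) (λ v → T? (χ v)) (λ v → T? (ω v))
      L.dominator O.dominator L.dominator∈ O.dominator∈ L.dominator-fixed O.dominator-fixed
      L.dominator-near O.dominator-near W (spacing m c t) p (n≤1+n _) exchange)

-- Polynomials

addᵖ : Polynomial → Polynomial → Polynomial
addᵖ []      q       = q
addᵖ (a ∷ p) []      = a ∷ p
addᵖ (a ∷ p) (b ∷ q) = a + b ∷ addᵖ p q

mulᵖ : Polynomial → Polynomial → Polynomial
mulᵖ []      q = []
mulᵖ (a ∷ p) q = addᵖ (List.map (a *_) q) (0 ∷ mulᵖ p q)

eval-addᵖ : ∀ p q x → eval (addᵖ p q) x ≡ eval p x + eval q x
eval-addᵖ []      q       x = refl
eval-addᵖ (a ∷ p) []      x = sym (+-identityʳ _)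
eval-addᵖ (a ∷ p) (b ∷ q) x = trans (cong (λ y → a + b + x * y) (eval-addᵖ p q x)) (e a b x (eval p x) (eval q x))
  where
  e : ∀ a b x y z → a + b + x * (y + z) ≡ a + x * y + (b + x * z)
  e = solve-∀

eval-scale : ∀ a q x → eval (List.map (a *_) q) x ≡ a * eval q x
eval-scale a []      x = sym (*-zeroʳ a)
eval-scale a (b ∷ q) x = trans (cong (λ y → a * b + x * y) (eval-scale a q x)) (e a b x (eval q x))
  where
  e : ∀ a b x y → a * b + x * (a * y) ≡ a * (b + x * y)
  e = solve-∀

eval-mulᵖ : ∀ p q x → eval (mulᵖ p q) x ≡ eval p x * eval q x
eval-mulᵖ []      q x = refl
eval-mulᵖ (a ∷ p) q x = begin
  eval (addᵖ (List.map (a *_) q) (0 ∷ mulᵖ p q)) x        ≡⟨ eval-addᵖ (List.map (a *_) q) (0 ∷ mulᵖ p q) x ⟩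
  eval (List.map (a *_) q) x + x * eval (mulᵖ p q) x      ≡⟨ cong₂ (λ y z → y + x * z) (eval-scale a q x) (eval-mulᵖ p q x) ⟩
  a * eval q x + x * (eval p x * eval q x)                ≡⟨ e a x (eval p x) (eval q x) ⟩
  (a + x * eval p x) * eval q x                           ∎
  where
  open ≡-Reasoning
  e : ∀ a x y z → a * z + x * (y * z) ≡ (a + x * y) * z
  e = solve-∀

eval-mono : ∀ p {x y} → x ≤ y → eval p x ≤ eval p y
eval-mono []      x≤y = z≤n
eval-mono (a ∷ p) x≤y = +-monoʳ-≤ a (*-mono-≤ x≤y (eval-mono p x≤y))

IsPolynomial : (ℕ → ℕ) → Set
IsPolynomial f = ∃[ p ] (∀ x → f x ≡ eval p x)

infixl 6 _⊕_
infixl 7 _⊗_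

_⊕_ : ∀ {f g} → IsPolynomial f → IsPolynomial g → IsPolynomial (λ x → f x + g x)
(p , f) ⊕ (q , g) = addᵖ p q , λ x → trans (cong₂ _+_ (f x) (g x)) (sym (eval-addᵖ p q x))

_⊗_ : ∀ {f g} → IsPolynomial f → IsPolynomial g → IsPolynomial (λ x → f x * g x)
(p , f) ⊗ (q , g) = mulᵖ p q , λ x → trans (cong₂ _*_ (f x) (g x)) (sym (eval-mulᵖ p q x))

con : ∀ k → IsPolynomial (λ _ → k)
con k = k ∷ [] , λ x → sym (trans (cong (k +_) (*-zeroʳ x)) (+-identityʳ k))

ind : IsPolynomial id
ind = 0 ∷ 1 ∷ [] , λ x → sym (e x)
  where
  e : ∀ x → x * (1 + x * 0) ≡ x
  e = solve-∀

pow : ∀ {f} → IsPolynomial f → ∀ k → IsPolynomial (λ x → f x ^ k)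
pow f zero    = con 1
pow f (suc k) = f ⊗ pow f k

-- `l` is an arbitrary polynomial because the recursion replaces it by `l` times `suc n`.
expandsTime-polynomial : ∀ K {l} → IsPolynomial l → IsPolynomial (λ n → expandsTime n K (l n))
expandsTime-polynomial zero    l = con 2
expandsTime-polynomial (suc K) l =
  con 6 ⊕ (l ⊗ (con 15 ⊕ (ind ⊗ (con 36 ⊕ ind ⊗ con 11))) ⊕ expandsTime-polynomial K (l ⊗ (con 1 ⊕ ind)))

mainTime-polynomial : ∀ K → IsPolynomial (mainTime K)
mainTime-polynomial K = con 16 ⊕ (ind ⊗ (con 2 ⊕ step) ⊕ (con 2 ⊕ ind ⊗ con 12))
  where
  cover  = ind ⊗ (con 32 ⊕ ind ⊗ con 20)
  choice = con 41 ⊕ (ind ⊗ con 12 ⊕ (con 2 ⊕ ind ⊗ con 13) ⊕ (con 2 ⊕ cover))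
  step   = con 10 ⊕ (con 2 ⊕ pow (con 1 ⊕ ind) K ⊗ (con 2 ⊕ choice) ⊕ expandsTime-polynomial K (con 1))

length≤size : ∀ {A : Set} (f : A → Tree) xs → length xs ≤ size (encodeList f xs)
length≤size f []       = z≤n
length≤size f (x ∷ xs) = s≤s (≤-trans (length≤size f xs) (m≤n+m _ (size (f x))))

n≤size : ∀ I → Instance.n I ≤ size (encode I)
n≤size I = begin
  n                                             ≡⟨ length-tabulate {n = n} id ⟨
  length (allFin n)                             ≤⟨ length≤size _ (allFin n) ⟩
  size (encodeGraph graph)                      ≤⟨ m≤n⇒m≤1+n (m≤m+n _ (size (encodeRepresentation representation))) ⟩
  size (encode I)                               ∎
  where
  open Instance I
  open ≤-Reasoning

-- The approximation algorithm

∈⇒T : ∀ {n} {D : Subset n} {v} → v ∈ D → T (lookup D v)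
∈⇒T v∈D = from T-≡ ([]=⇒lookup v∈D)

T⇒∈ : ∀ {n} {D : Subset n} {v} → T (lookup D v) → v ∈ D
T⇒∈ {D = D} {v} t = lookup⇒[]= v D (to T-≡ t)

∣∣≡# : ∀ {n} (D : Subset n) → ∣ D ∣ ≡ # (λ v → T? (lookup D v))
∣∣≡# Vec.[]            = refl
∣∣≡# (true  Vec.∷ D) = cong suc (∣∣≡# D)
∣∣≡# (false Vec.∷ D) = ∣∣≡# D

#true-tabulate : ∀ {n} (χ : Fin n → Bool) → #true (List.tabulate χ) ≡ # (λ v → T? (χ v))
#true-tabulate {zero}  χ = refl
#true-tabulate {suc n} χ with χ Fin.zero
... | true  = cong suc (#true-tabulate (χ ∘ Fin.suc))
... | false = #true-tabulate (χ ∘ Fin.suc)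

differ-tabulate : ∀ {n} (χ ψ : Fin n → Bool) →
  Differ (# (λ v → T? (χ v xor ψ v))) (List.tabulate χ) (List.tabulate ψ)
differ-tabulate {zero}  χ ψ = []
differ-tabulate {suc n} χ ψ with χ Fin.zero | ψ Fin.zero
... | true  | true  = same true (differ-tabulate (χ ∘ Fin.suc) (ψ ∘ Fin.suc))
... | true  | false = diff true (differ-tabulate (χ ∘ Fin.suc) (ψ ∘ Fin.suc))
... | false | true  = diff false (differ-tabulate (χ ∘ Fin.suc) (ψ ∘ Fin.suc))
... | false | false = same false (differ-tabulate (χ ∘ Fin.suc) (ψ ∘ Fin.suc))

encodeSubset-tabulate : ∀ {n} (χ : Fin n → Bool) → encodeSubset (Vec.tabulate χ) ≡ enc (List.tabulate χ)
encodeSubset-tabulate {zero}  χ = refl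
encodeSubset-tabulate {suc n} χ = cong (encodeBool (χ Fin.zero) ∙_) (encodeSubset-tabulate (χ ∘ Fin.suc))

at-tabulate : ∀ {n} (χ : Fin n → Bool) v → at (List.tabulate χ) (toℕ v) ≡ χ v
at-tabulate χ Fin.zero    = refl
at-tabulate χ (Fin.suc v) = at-tabulate (χ ∘ Fin.suc) v

module _ {n} (G : Graph n) where

  dominating? : ∀ D → Dec (Dominating G D)
  dominating? D = all? λ v → ¬? (v ∈? D) →-dec any? λ u → u ∈? D ×-dec T? (Graph.adj G v u)

  dominating⇒covered : ∀ {D} → Dominating G D → ∀ v → Covered (Graph.adj G) (lookup D) v
  dominating⇒covered {D} dom v with v ∈? D
  ... | yes v∈D = inj₁ (∈⇒T v∈D)
  ... | no v∉D  = let u , u∈D , vu = dom v v∉D in inj₂ (u , vu , ∈⇒T u∈D)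

  covered⇒dominating : ∀ {D} → (∀ v → Covered (Graph.adj G) (lookup D) v) → Dominating G D
  covered⇒dominating cov v v∉D with cov v
  ... | inj₁ t            = ⊥-elim (v∉D (T⇒∈ t))
  ... | inj₂ (u , vu , t) = u , T⇒∈ t , vu

  -- A minimum has to be exhibited constructively; it is found by descent from the full set, with
  -- `k` bounding the number of steps.
  dominationNumber : ∃ (IsDominationNumber G)
  dominationNumber = search ∣ ⊤ {n} ∣ ⊤ (λ v v∉⊤ → ⊥-elim (v∉⊤ ∈⊤)) ≤-refl
    where
    search : ∀ k D → Dominating G D → ∣ D ∣ ≤ k → ∃ (IsDominationNumber G)
    search k D dom ∣D∣≤k with anySubset? (λ E → dominating? E ×-dec ∣ E ∣ <? ∣ D ∣)
    search k D dom ∣D∣≤k | no none = ∣ D ∣ , record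
      { attained = D , dom , refl
      ; minimal  = λ E dom′ → ≮⇒≥ λ lt → none (E , dom′ , lt)
      }
    search zero    D dom ∣D∣≤k | yes (E , dom′ , lt) = ⊥-elim (n≮0 (≤-trans lt ∣D∣≤k))
    search (suc k) D dom ∣D∣≤k | yes (E , dom′ , lt) = search k E dom′ (s≤s⁻¹ (≤-trans lt ∣D∣≤k))

-- A positive fraction is at least the reciprocal of its denominator, here `suc m`; so a ratio of
-- `1 + 1/(m + 1)` is good enough for `ε`.
fromℕ-ratio : ∀ ε → 0ℚ ℚ.< ε → ∃[ m ] ∀ x y → suc m * x ≤ suc (suc m) * y → fromℕ x ℚ.≤ (1ℚ ℚ.+ ε) ℚ.* fromℕ y
fromℕ-ratio (mkℚ -[1+ _ ] d _) (ℚ.*<* ())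
fromℕ-ratio (mkℚ (pos 0)    d _) (ℚ.*<* (+<+ ()))
fromℕ-ratio ε@(mkℚ (+[1+ k ]) m _) _ = m , λ x y p → ℚ.toℚᵘ-cancel-≤ (begin
  toℚᵘ (fromℕ x)
    ≃⟨ ℚ.toℚᵘ-fromℚᵘ (mkℚᵘ (pos x) 0) ⟩
  mkℚᵘ (pos x) 0
    ≤⟨ *≤* (subst₂ ℤ._≤_ (ℤ.pos-* x (1 * suc m * 1))
         (trans (ℤ.pos-* ((1 * suc m + suc k * 1) * y) 1)
                (cong (ℤ._* pos 1) (ℤ.pos-* (1 * suc m + suc k * 1) y)))
         (+≤+ (bound x y p))) ⟩
  (mkℚᵘ (pos 1) 0 ℚᵘ.+ mkℚᵘ +[1+ k ] m) ℚᵘ.* mkℚᵘ (pos y) 0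
    ≃⟨ ℚᵘ.*-cong (ℚ.toℚᵘ-homo-+ 1ℚ ε) (ℚ.toℚᵘ-fromℚᵘ (mkℚᵘ (pos y) 0)) ⟨
  toℚᵘ (1ℚ ℚ.+ ε) ℚᵘ.* toℚᵘ (fromℕ y)
    ≃⟨ ℚ.toℚᵘ-homo-* (1ℚ ℚ.+ ε) (fromℕ y) ⟨
  toℚᵘ ((1ℚ ℚ.+ ε) ℚ.* fromℕ y)   ∎)
  where
  open ℚᵘ.≤-Reasoning
  e : ∀ m x → x * (1 * suc m * 1) ≡ suc m * x
  e = solve-∀
  e′ : ∀ m k y → suc (suc m) * y + k * y ≡ (1 * suc m + suc k * 1) * y * 1
  e′ = solve-∀
  bound : ∀ x y → suc m * x ≤ suc (suc m) * y → x * (1 * suc m * 1) ≤ (1 * suc m + suc k * 1) * y * 1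
  bound x y p = ≤-trans (≤-reflexive (e m x)) (≤-trans p (≤-trans (m≤m+n _ (k * y)) (≤-reflexive (e′ m k y))))

module Solution {n} (G : Graph n) (K : ℕ) where
  open Graph G using (adj)
  open LocalSearch adj using (dominates)

  solutionˡ : List Bool
  solutionˡ = rounds K adj n (replicate n true)

  length-solutionˡ : length solutionˡ ≡ n
  length-solutionˡ = length-rounds adj K n (replicate n true) (length-replicate n)

  χ : Fin n → Bool
  χ v = at solutionˡ (toℕ v)

  tabulate-χ : List.tabulate χ ≡ solutionˡ
  tabulate-χ = tabulate-at solutionˡ length-solutionˡ

  dominates-tabulate : ∀ ψ → (∀ v → Covered adj ψ v) → T (dominates (List.tabulate ψ))
  dominates-tabulate ψ covered = covers-complete adj (λ v → at (List.tabulate ψ) (toℕ v)) true (allFin n) tt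
    λ v → [ inj₁ ∘ subst T (sym (at-tabulate ψ v)) ,
            (λ (u , vu , t) → inj₂ (u , vu , subst T (sym (at-tabulate ψ u)) t)) ]′ (covered v)

  χ-covered : ∀ v → Covered adj χ v
  χ-covered v = covers-sound adj χ true (allFin n) (∈-allFin v)
    (rounds-dominates adj K n (replicate n true)
      (subst (T ∘ dominates) (tabulate-true n) (dominates-tabulate (λ _ → true) λ _ → inj₁ tt)))
    where
    tabulate-true : ∀ k → List.tabulate {n = k} (λ _ → true) ≡ replicate k true
    tabulate-true zero    = refl
    tabulate-true (suc k) = cong (true ∷_) (tabulate-true k)

  χ-locally-optimal : ∀ ψ → (∀ v → Covered adj ψ v) → # (λ v → T? (χ v xor ψ v)) ≤ K →
    # (λ v → T? (χ v)) ≤ # (λ v → T? (ψ v))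
  χ-locally-optimal ψ covered close = subst₂ _≤_ (#true-tabulate χ) (#true-tabulate ψ)
    (subst (LocallyOptimal adj K) (sym tabulate-χ)
      (rounds-locallyOptimal adj K n (replicate n true) (≤-reflexive (#true-replicate n)))
      close (differ-tabulate χ ψ) (dominates-tabulate ψ covered))
    where
    #true-replicate : ∀ k → #true (replicate k true) ≡ k
    #true-replicate zero    = refl
    #true-replicate (suc k) = cong suc (#true-replicate k)

  solution : Subset n
  solution = Vec.tabulate χ

  solution-dominating : Dominating G solution
  solution-dominating = covered⇒dominating G λ v → [ inj₁ ∘ subst T (sym (lookup∘tabulate χ v)) ,
    (λ (u , vu , t) → inj₂ (u , vu , subst T (sym (lookup∘tabulate χ u)) t)) ]′ (χ-covered v)

  ∣solution∣ : ∣ solution ∣ ≡ # (λ v → T? (χ v))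
  ∣solution∣ = trans (∣∣≡# solution) (sum-cong-≗ λ v → cong (ι ∘ T?) (lookup∘tabulate χ v))

localSearch : ℕ → Program
localSearch K = record { #auxiliary = 9 ; body = main K }

computes : ∀ {n} (G : Graph n) K t →
  ∃[ m ] (Computes localSearch K On (encodeGraph G ∙ t) InTime m) (encodeSubset (Solution.solution G K))
    × m ≤ mainTime K n
computes G K t =
  let τ , m , halts , m≤b = main≤ K (Graph.adj G) {t}
  in m , (_ , halts , sym (trans (encodeSubset-tabulate χ) (cong enc tabulate-χ))) , m≤b
  where open Solution G K

guarantee : ∀ {b t c I} .{{_ : NonZero c}} m {γ} → Restricted b t c I → let open Instance I in
  IsDominationNumber graph γ → suc m * ∣ Solution.solution graph (radius m c t) ∣ ≤ suc (suc m) * γ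
guarantee {t = t} {c} {I} m {γ} restricted γ-number = subst₂ (λ x y → suc m * x ≤ suc (suc m) * y)
  (sym ∣solution∣) (trans (sym (∣∣≡# S)) ∣S∣≡γ)
  (Ratio.ratio m (drawing restricted) (Graph.adj graph) (adjacent-visits restricted) χ (lookup S)
    χ-covered (dominating⇒covered graph S-dominating) χ-locally-optimal)
  where
  open Instance I
  open Solution graph (radius m c t)
  S             = proj₁ (IsDominationNumber.attained γ-number)
  S-dominating  = proj₁ (proj₂ (IsDominationNumber.attained γ-number))
  ∣S∣≡γ         = proj₂ (proj₂ (IsDominationNumber.attained γ-number))

theorem13 : (t c : ℕ) → 1 ≤ c → (b : Polynomial) → DominatingSetHasPTAS (Restricted b t c)
theorem13 t c 1≤c b ε 0<ε _ = localSearch K , record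
  { time    = proj₁ time
  ; correct = λ I restricted →
      let open Instance I
          open Solution graph K
          steps , halts , bound = computes graph K (encodeRepresentation representation)
          γ , γ-number          = dominationNumber graph
      in solution , steps , γ , halts ,
         ≤-trans bound (≤-trans (≤-reflexive (proj₂ time n)) (eval-mono (proj₁ time) (n≤size I))) ,
         solution-dominating , γ-number ,
         proj₂ (fromℕ-ratio ε 0<ε) ∣ solution ∣ γ (guarantee {{>-nonZero 1≤c}} m restricted γ-number)
  }
  where
  m    = proj₁ (fromℕ-ratio ε 0<ε)
  K    = radius m c t
  time = mainTime-polynomial K
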